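{- Let $w\in S_n$. The set $\mathsf{Pipes}(w)$ is closed under applying droops and K-theoretic droops. Furthermore, any $\mathcal P\in\mathsf{Pipes}(w)$ can be reached from $\Phi(w)$ by applying a sequence of droops and K-theoretic droops.
   Context: Bumpless pipe dreams. Cells $(i,j)$ of the $n\times n$ grid: row $i$ from the top, column $j$ from the left. There are six tiles: downward elbow (a pipe joining the bottom and right edges), upward elbow (a pipe joining the left and top edges), crossing (one pipe joining left and right edges and one joining bottom and top edges), blank (no pipe), horizontal (left to right), vertical (bottom to top). A bumpless pipe dream (BPD) of size $n$ is a tiling of the grid by these tiles such that an edge shared by two cells is met by a pipe from both sides or from neither, every bottom and right boundary edge is met by a pipe, and no left or top boundary edge is met by a pipe. A BPD is determined by the positions of its downward elbows and of its upward elbows. $\Phi(w)$ is the Rothe BPD of $w$: the unique BPD with downward elbows exactly at the positions $(i,w(i))$, $i=1,\dots,n$, and no upward elbows. Demazure product $\partial(\mathcal P)\in S_n$: label the bottom boundary edges $1,\dots,n$ from left to right and propagate labels along pipes north and east; at a crossing tile, of the two labels entering from the left and from below, the smaller leaves through the right edge and the larger through the top edge. $\partial(\mathcal P)(i)$ is the label arriving at the right boundary edge of row $i$. $\mathsf{Pipes}(w)$ is the set of BPDs $\mathcal P$ of size $n$ with $\partial(\mathcal P)=w$. In each of the following moves, $R=[i,a]\times[j,b]$ is a rectangle of cells with $i<a$, $j<b$; the elbow tiles outside $R$ are unchanged, and the new BPD is the one determined by the new set of elbow tiles. Droop: allowed when $(i,j)$ is a downward elbow, $(a,b)$ is blank,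 and $R$ contains no other elbow tiles. In the new BPD the elbow tiles in $R$ are exactly: downward elbows at $(a,j)$ and $(i,b)$ and an upward elbow at $(a,b)$. K-theoretic droop, first type: for some $j<j'<b$, allowed when the elbow tiles in $R$ are exactly downward elbows at $(i,j)$ and $(a,j')$ and an upward elbow at $(a,b)$. In the new BPD the elbow tiles in $R$ are exactly downward elbows at $(a,j)$ and $(i,j')$ and an upward elbow at $(a,b)$. K-theoretic droop, second type: for some $i<i'<a$, allowed when the elbow tiles in $R$ are exactly downward elbows at $(i,j)$ and $(i',b)$ and an upward elbow at $(a,b)$. In the new BPD the elbow tiles in $R$ are exactly downward elbows at $(i',j)$ and $(i,b)$ and an upward elbow at $(a,b)$. -}

module Defs where

open import Data.Bool.Base using (Bool; true; false; not; _∧_; _∨_; if_then_else_)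
open import Data.Empty using (⊥-elim)
open import Data.Fin.Base using (Fin; zero; suc; toℕ; fromℕ<; _≤_; _<_)
open import Data.Fin.Permutation using (Permutation′; _⟨$⟩ʳ_; _⟨$⟩ˡ_; inverseˡ; inverseʳ)
open import Data.Fin.Properties using (_≟_; _≤?_; _<?_; toℕ<n; toℕ-fromℕ<; toℕ-injective)
open import Data.List.Base using (List; []; _∷_)
open import Data.List.Membership.Propositional using (_∈_)
open import Data.Maybe.Base using (Maybe; just; nothing)
open import Data.Nat.Base as ℕ using (ℕ; zero; suc)
import Data.Nat.Properties as ℕ
open import Data.Product.Base using (_×_; _,_; proj₁; proj₂; ∃-syntax)
open import Data.Sum.Base using (_⊎_; inj₁; inj₂; [_,_]′)
open import Data.Vec.Functional using (Vector; head; tail) renaming ([] to []ᵛ; _∷_ to _∷ᵛ_)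
open import Function.Base using (_∘_)
open import Function.Bundles using (_⇔_; mk⇔; Equivalence)
open import Relation.Binary.PropositionalEquality
  using (_≡_; refl; sym; trans; cong; subst; module ≡-Reasoning)
open import Relation.Nullary using (¬_; Dec; does; yes; no)
open import Relation.Nullary.Decidable
  using (does-⇔; dec-true; dec-false; ¬?; _×-dec_; _⊎-dec_)
open import Relation.Unary using (Pred)
open import Level using (0ℓ)

private
  variable
    n : ℕ

------------------------------------------------------------------------
-- Tiles

data Elbow : Set where
  downward upward : Elbow

data Tile : Set where
  elbow                                : Elbow → Tile
  crossing blank horizontal vertical : Tile

-- Whether a pipe meets the given edge of the tile.

left right top bottom : Tile → Bool

left (elbow downward) = false
left (elbow upward)   = true
left crossing         = true
left blank            = false
left horizontal       = true
left vertical         = false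

right (elbow downward) = true
right (elbow upward)   = false
right crossing         = true
right blank            = false
right horizontal       = true
right vertical         = false

top (elbow downward) = false
top (elbow upward)   = true
top crossing         = true
top blank            = false
top horizontal       = false
top vertical         = true

bottom (elbow downward) = true
bottom (elbow upward)   = false
bottom crossing         = true
bottom blank            = false
bottom horizontal       = false
bottom vertical         = true

------------------------------------------------------------------------
-- Bumpless pipe dreams

-- The cell in row i from the top and column j from the left is tile i j;
-- rows and columns are numbered from 0.

record BPD (n : ℕ) : Set where
  field
    tile            : Fin n → Fin n → Tile
    left-right      : ∀ i {j j′} → toℕ j′ ≡ suc (toℕ j) →
                      right (tile i j) ≡ left (tile i j′)
    top-bottom      : ∀ {i i′} j → toℕ i′ ≡ suc (toℕ i) →
                      bottom (tile i j) ≡ top (tile i′ j)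
    left-boundary   : ∀ i j → toℕ j ≡ 0 → left (tile i j) ≡ false
    right-boundary  : ∀ i j → suc (toℕ j) ≡ n → right (tile i j) ≡ true
    top-boundary    : ∀ i j → toℕ i ≡ 0 → top (tile i j) ≡ false
    bottom-boundary : ∀ i j → suc (toℕ i) ≡ n → bottom (tile i j) ≡ true

open BPD public

-- Equality of BPDs as tilings: the proof fields are disregarded.

infix 4 _≈_

_≈_ : BPD n → BPD n → Set
P ≈ Q = ∀ i j → tile P i j ≡ tile Q i j

------------------------------------------------------------------------
-- Demazure product

-- The label carried by an edge; nothing if no pipe meets the edge.

Label : ℕ → Set
Label n = Maybe (Fin n)

-- From the labels on the left and bottom edges of a tile to those on its
-- right and top edges.  The last clause does not occur in a BPD.

propagate : Tile → Label n → Label n → Label n × Label n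
propagate (elbow downward) l        b        = b , nothing
propagate (elbow upward)   l        b        = nothing , l
propagate blank            l        b        = nothing , nothing
propagate horizontal       l        b        = l , nothing
propagate vertical         l        b        = nothing , b
propagate crossing         (just x) (just y) =
  if does (x ≤? y) then (just x , just y) else (just y , just x)
propagate crossing         l        b        = l , b

-- One row, from left to right: given the label entering the row from the
-- left and those entering from below, returns the label leaving through
-- the right edge and those leaving through the top edges.

propagateRow : ∀ {m} → Vector Tile m → Label n → Vector (Label n) m →
               Label n × Vector (Label n) m
propagateRow {m = zero}  ts l bs = l , []ᵛ
propagateRow {m = suc m} ts l bs =
  let r , t  = propagate (head ts) l (head bs)
      e , us = propagateRow (tail ts) r (tail bs)
  in e , (t ∷ᵛ us)

-- All rows, from bottom (the last row) to top: returns the labels at the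
-- right edges of the rows and those at the top edges of the columns.

propagateRows : ∀ {k m} → Vector (Vector Tile m) k → Vector (Label n) m →
                Vector (Label n) k × Vector (Label n) m
propagateRows {k = zero}  T bs = []ᵛ , bs
propagateRows {k = suc k} T bs =
  let es , us = propagateRows (tail T) bs
      e  , vs = propagateRow (head T) nothing us
  in (e ∷ᵛ es) , vs

∂ : BPD n → Fin n → Label n
∂ P = proj₁ (propagateRows (tile P) just)

Pipes : Permutation′ n → Pred (BPD n) 0ℓ
Pipes w P = ∀ i → ∂ P i ≡ just (w ⟨$⟩ʳ i)

------------------------------------------------------------------------
-- A BPD is determined by its elbows

SameElbow : Tile → Tile → Set
SameElbow s t = ∀ e → s ≡ elbow e ⇔ t ≡ elbow e

private

  same-elbow-cases : ∀ s t → SameElbow s t →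
    (s ≡ t) ⊎ ((left s ≡ right s × left t ≡ right t) ×
               (top s ≡ bottom s × top t ≡ bottom t))
  same-elbow-cases (elbow e) t f = inj₁ (sym (Equivalence.to (f e) refl))
  same-elbow-cases s (elbow e) f = inj₁ (Equivalence.from (f e) refl)
  same-elbow-cases crossing   crossing   f = inj₁ refl
  same-elbow-cases crossing   blank      f = inj₂ ((refl , refl) , (refl , refl))
  same-elbow-cases crossing   horizontal f = inj₂ ((refl , refl) , (refl , refl))
  same-elbow-cases crossing   vertical   f = inj₂ ((refl , refl) , (refl , refl))
  same-elbow-cases blank      crossing   f = inj₂ ((refl , refl) , (refl , refl))
  same-elbow-cases blank      blank      f = inj₁ refl
  same-elbow-cases blank      horizontal f = inj₂ ((refl , refl) , (refl , refl))
  same-elbow-cases blank      vertical   f = inj₂ ((refl , refl) , (refl , refl))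
  same-elbow-cases horizontal crossing   f = inj₂ ((refl , refl) , (refl , refl))
  same-elbow-cases horizontal blank      f = inj₂ ((refl , refl) , (refl , refl))
  same-elbow-cases horizontal horizontal f = inj₁ refl
  same-elbow-cases horizontal vertical   f = inj₂ ((refl , refl) , (refl , refl))
  same-elbow-cases vertical   crossing   f = inj₂ ((refl , refl) , (refl , refl))
  same-elbow-cases vertical   blank      f = inj₂ ((refl , refl) , (refl , refl))
  same-elbow-cases vertical   horizontal f = inj₂ ((refl , refl) , (refl , refl))
  same-elbow-cases vertical   vertical   f = inj₁ refl

  right-determined : ∀ s t → SameElbow s t → left s ≡ left t → right s ≡ right t
  right-determined s t f q with same-elbow-cases s t f
  ... | inj₁ s≡t           = cong right s≡t
  ... | inj₂ ((x , y) , _) = trans (sym x) (trans q y)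

  bottom-determined : ∀ s t → SameElbow s t → top s ≡ top t → bottom s ≡ bottom t
  bottom-determined s t f q with same-elbow-cases s t f
  ... | inj₁ s≡t           = cong bottom s≡t
  ... | inj₂ (_ , (x , y)) = trans (sym x) (trans q y)

  tile-determined : ∀ s t → SameElbow s t →
                    left s ≡ left t → top s ≡ top t → s ≡ t
  tile-determined (elbow e)  t          f _ _  = sym (Equivalence.to (f e) refl)
  tile-determined crossing   (elbow e)  f _ _  = Equivalence.from (f e) refl
  tile-determined blank      (elbow e)  f _ _  = Equivalence.from (f e) refl
  tile-determined horizontal (elbow e)  f _ _  = Equivalence.from (f e) refl
  tile-determined vertical   (elbow e)  f _ _  = Equivalence.from (f e) refl
  tile-determined crossing   crossing   f _ _  = refl
  tile-determined crossing   blank      f () _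
  tile-determined crossing   horizontal f _ ()
  tile-determined crossing   vertical   f () _
  tile-determined blank      crossing   f () _
  tile-determined blank      blank      f _ _  = refl
  tile-determined blank      horizontal f () _
  tile-determined blank      vertical   f _ ()
  tile-determined horizontal crossing   f _ ()
  tile-determined horizontal blank      f () _
  tile-determined horizontal horizontal f _ _  = refl
  tile-determined horizontal vertical   f () _
  tile-determined vertical   crossing   f () _
  tile-determined vertical   blank      f _ ()
  tile-determined vertical   horizontal f () _
  tile-determined vertical   vertical   f _ _  = refl

  predecessor : ∀ {k} (x : Fin n) → toℕ x ≡ suc k → ∃[ y ] toℕ {n} y ≡ k
  predecessor x q = fromℕ< k<n , toℕ-fromℕ< k<n
    where
    k<n = ℕ.<-trans (ℕ.n<1+n _) (subst (ℕ._< _) q (toℕ<n x))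

determined : (P Q : BPD n) → (∀ i j → SameElbow (tile P i j) (tile Q i j)) → P ≈ Q
determined P Q f i j =
  tile-determined (tile P i j) (tile Q i j) (f i j)
                  (lefts (toℕ j) i j refl) (tops (toℕ i) i j refl)
  where
  lefts : ∀ k i j → toℕ j ≡ k → left (tile P i j) ≡ left (tile Q i j)
  lefts zero    i j q = trans (left-boundary P i j q) (sym (left-boundary Q i j q))
  lefts (suc k) i j q with predecessor j q
  ... | j₀ , refl = trans (sym (left-right P i q)) (trans
    (right-determined _ _ (f i j₀) (lefts k i j₀ refl)) (left-right Q i q))

  tops : ∀ k i j → toℕ i ≡ k → top (tile P i j) ≡ top (tile Q i j)
  tops zero    i j q = trans (top-boundary P i j q) (sym (top-boundary Q i j q))
  tops (suc k) i j q with predecessor i q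
  ... | i₀ , refl = trans (sym (top-bottom P j q)) (trans
    (bottom-determined _ _ (f i₀ j) (tops k i₀ j refl)) (top-bottom Q j q))

------------------------------------------------------------------------
-- Rothe BPD

-- The tile with a downward elbow if d holds; otherwise with a horizontal
-- pipe if h holds and a vertical one if v holds.

rotheTile : (d h v : Bool) → Tile
rotheTile true  _     _     = elbow downward
rotheTile false true  true  = crossing
rotheTile false true  false = horizontal
rotheTile false false true  = vertical
rotheTile false false false = blank

private

  left-rothe : ∀ d h v → left (rotheTile d h v) ≡ not d ∧ h
  left-rothe true  _     _     = refl
  left-rothe false true  true  = refl
  left-rothe false true  false = refl
  left-rothe false false true  = refl
  left-rothe false false false = refl

  right-rothe : ∀ d h v → right (rotheTile d h v) ≡ d ∨ h
  right-rothe true  _     _     = refl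
  right-rothe false true  true  = refl
  right-rothe false true  false = refl
  right-rothe false false true  = refl
  right-rothe false false false = refl

  top-rothe : ∀ d h v → top (rotheTile d h v) ≡ not d ∧ v
  top-rothe true  _     _     = refl
  top-rothe false true  true  = refl
  top-rothe false true  false = refl
  top-rothe false false true  = refl
  top-rothe false false false = refl

  bottom-rothe : ∀ d h v → bottom (rotheTile d h v) ≡ d ∨ v
  bottom-rothe true  _     _     = refl
  bottom-rothe false true  true  = refl
  bottom-rothe false true  false = refl
  bottom-rothe false false true  = refl
  bottom-rothe false false false = refl

  elbow-rothe : ∀ {A : Set} (a? : Dec A) h v e →
                rotheTile (does a?) h v ≡ elbow e ⇔ (e ≡ downward × A)
  elbow-rothe (yes a) h v e = mk⇔ (λ { refl → refl , a }) (λ { (refl , _) → refl })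
  elbow-rothe (no ¬a) h v e =
    mk⇔ (λ q → ⊥-elim (no-elbow h v q)) (λ { (_ , a) → ⊥-elim (¬a a) })
    where
    no-elbow : ∀ h v → ¬ (rotheTile false h v ≡ elbow e)
    no-elbow true  true  ()
    no-elbow true  false ()
    no-elbow false true  ()
    no-elbow false false ()

module _ (w : Permutation′ n) where

  private

    d? : (i j : Fin n) → Dec (w ⟨$⟩ʳ i ≡ j)
    d? i j = w ⟨$⟩ʳ i ≟ j

    h? : (i j : Fin n) → Dec (w ⟨$⟩ʳ i < j)
    h? i j = w ⟨$⟩ʳ i <? j

    v? : (i j : Fin n) → Dec (w ⟨$⟩ˡ j < i)
    v? i j = w ⟨$⟩ˡ j <? i

    d⇒ : ∀ {i j} → w ⟨$⟩ʳ i ≡ j → w ⟨$⟩ˡ j ≡ i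
    d⇒ refl = inverseˡ w

    d⇐ : ∀ {i j} → w ⟨$⟩ˡ j ≡ i → w ⟨$⟩ʳ i ≡ j
    d⇐ refl = inverseʳ w

    ≤⇒≡⊎< : {x y : Fin n} → x ≤ y → x ≡ y ⊎ x < y
    ≤⇒≡⊎< x≤y with ℕ.m≤n⇒m<n∨m≡n x≤y
    ... | inj₁ x<y = inj₂ x<y
    ... | inj₂ x≡y = inj₁ (toℕ-injective x≡y)

    ≡⊎<⇒≤ : {x y : Fin n} → x ≡ y ⊎ x < y → x ≤ y
    ≡⊎<⇒≤ (inj₁ refl) = ℕ.≤-refl
    ≡⊎<⇒≤ (inj₂ x<y)  = ℕ.<⇒≤ x<y

    t : Fin n → Fin n → Tile
    t i j = rotheTile (does (d? i j)) (does (h? i j)) (does (v? i j))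

    left-t : (i j : Fin n) → left (t i j) ≡ does (h? i j)
    left-t i j = trans (left-rothe (does (d? i j)) (does (h? i j)) (does (v? i j)))
      (does-⇔ (mk⇔ proj₂ (λ x<y → (λ { refl → ℕ.<-irrefl refl x<y }) , x<y))
              (¬? (d? i j) ×-dec h? i j) (h? i j))

    top-t : (i j : Fin n) → top (t i j) ≡ does (v? i j)
    top-t i j = trans (top-rothe (does (d? i j)) (does (h? i j)) (does (v? i j)))
      (does-⇔ (mk⇔ proj₂ (λ x<y → (λ q → ℕ.<-irrefl (cong toℕ (d⇒ q)) x<y) , x<y))
              (¬? (d? i j) ×-dec v? i j) (v? i j))

    right-t : (i j : Fin n) → right (t i j) ≡ does (w ⟨$⟩ʳ i ≤? j)
    right-t i j = trans (right-rothe (does (d? i j)) (does (h? i j)) (does (v? i j)))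
      (does-⇔ (mk⇔ ≡⊎<⇒≤ ≤⇒≡⊎<) (d? i j ⊎-dec h? i j) (w ⟨$⟩ʳ i ≤? j))

    bottom-t : (i j : Fin n) → bottom (t i j) ≡ does (w ⟨$⟩ˡ j ≤? i)
    bottom-t i j = trans (bottom-rothe (does (d? i j)) (does (h? i j)) (does (v? i j)))
      (does-⇔ (mk⇔ (λ { (inj₁ q) → ≡⊎<⇒≤ (inj₁ (d⇒ q)) ; (inj₂ q) → ℕ.<⇒≤ q })
                   (λ q → [ (λ p → inj₁ (d⇐ p)) , inj₂ ]′ (≤⇒≡⊎< q)))
              (d? i j ⊎-dec v? i j) (w ⟨$⟩ˡ j ≤? i))

    ≤⇔<suc : {x y y′ : Fin n} → toℕ y′ ≡ suc (toℕ y) → x ≤ y ⇔ x < y′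
    ≤⇔<suc {x} q = mk⇔ (λ x≤y → subst (toℕ x ℕ.<_) (sym q) (ℕ.s≤s x≤y))
                       (λ x<y′ → ℕ.≤-pred (subst (toℕ x ℕ.<_) q x<y′))

    ≮first : {x y : Fin n} → toℕ y ≡ 0 → ¬ (x < y)
    ≮first {x} q x<y = ℕ.n≮0 (subst (toℕ x ℕ.<_) q x<y)

    ≤last : {x y : Fin n} → suc (toℕ y) ≡ n → x ≤ y
    ≤last {x} q = ℕ.≤-pred (subst (toℕ x ℕ.<_) (sym q) (toℕ<n x))

  -- The horizontal part of the pipe leaving row i lies to the right of
  -- column w(i), and the vertical part of the pipe entering column j lies
  -- below row w⁻¹(j).

  Φ : BPD n
  Φ .tile i j = rotheTile (does (w ⟨$⟩ʳ i ≟ j)) (does (w ⟨$⟩ʳ i <? j)) (does (w ⟨$⟩ˡ j <? i))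
  Φ .left-right i {j} {j′} q =
    trans (right-t i j) (trans (does-⇔ (≤⇔<suc q) (w ⟨$⟩ʳ i ≤? j) (h? i j′)) (sym (left-t i j′)))
  Φ .top-bottom {i} {i′} j q =
    trans (bottom-t i j) (trans (does-⇔ (≤⇔<suc q) (w ⟨$⟩ˡ j ≤? i) (v? i′ j)) (sym (top-t i′ j)))
  Φ .left-boundary   i j q = trans (left-t i j)   (dec-false (h? i j) (≮first q))
  Φ .right-boundary  i j q = trans (right-t i j)  (dec-true (w ⟨$⟩ʳ i ≤? j) (≤last q))
  Φ .top-boundary    i j q = trans (top-t i j)    (dec-false (v? i j) (≮first q))
  Φ .bottom-boundary i j q = trans (bottom-t i j) (dec-true (w ⟨$⟩ˡ j ≤? i) (≤last q))

  -- With determined, this characterises Φ among all BPDs.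

  Φ-elbows : ∀ i j e → tile Φ i j ≡ elbow e ⇔ (e ≡ downward × w ⟨$⟩ʳ i ≡ j)
  Φ-elbows i j e = elbow-rothe (d? i j) (does (h? i j)) (does (v? i j)) e

------------------------------------------------------------------------
-- Droops and K-theoretic droops

-- [ i , a ] × [ j , b ], with i < a and j < b.

record Rectangle (n : ℕ) : Set where
  field
    {i a j b} : Fin n
    i<a       : i < a
    j<b       : j < b

open Rectangle using (i; a; j; b)

Inside : Rectangle n → Fin n → Fin n → Set
Inside R x y = (i R ≤ x × x ≤ a R) × (j R ≤ y × y ≤ b R)

data Move (n : ℕ) : Set where
  droop   : Rectangle n → Move n
  Kdroop₁ : (R : Rectangle n) (j′ : Fin n) → j R < j′ → j′ < b R → Move n
  Kdroop₂ : (R : Rectangle n) (i′ : Fin n) → i R < i′ → i′ < a R → Move n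

rectangle : Move n → Rectangle n
rectangle (droop R)          = R
rectangle (Kdroop₁ R _ _ _) = R
rectangle (Kdroop₂ R _ _ _) = R

ElbowList : ℕ → Set
ElbowList n = List ((Fin n × Fin n) × Elbow)

before after : Move n → ElbowList n

before (droop R) =
  ((i R , j R) , downward) ∷ []
before (Kdroop₁ R j′ _ _) =
  ((i R , j R) , downward) ∷ ((a R , j′) , downward) ∷ ((a R , b R) , upward) ∷ []
before (Kdroop₂ R i′ _ _) =
  ((i R , j R) , downward) ∷ ((i′ , b R) , downward) ∷ ((a R , b R) , upward) ∷ []

after (droop R) =
  ((a R , j R) , downward) ∷ ((i R , b R) , downward) ∷ ((a R , b R) , upward) ∷ []
after (Kdroop₁ R j′ _ _) =
  ((a R , j R) , downward) ∷ ((i R , j′) , downward) ∷ ((a R , b R) , upward) ∷ []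
after (Kdroop₂ R i′ _ _) =
  ((i′ , j R) , downward) ∷ ((i R , b R) , downward) ∷ ((a R , b R) , upward) ∷ []

ElbowsAreExactly : BPD n → Rectangle n → ElbowList n → Set
ElbowsAreExactly P R es =
  ∀ x y e → Inside R x y → tile P x y ≡ elbow e ⇔ ((x , y) , e) ∈ es

Allowed : Move n → BPD n → Set
Allowed (droop R)            P =
  ElbowsAreExactly P R (before (droop R)) × tile P (a R) (b R) ≡ blank
Allowed m@(Kdroop₁ R _ _ _) P = ElbowsAreExactly P R (before m)
Allowed m@(Kdroop₂ R _ _ _) P = ElbowsAreExactly P R (before m)

-- By determined, Result m P Q holds for at most one Q up to _≈_.

Result : Move n → BPD n → BPD n → Set
Result m P Q =
  ElbowsAreExactly Q (rectangle m) (after m) ×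
  (∀ x y → ¬ Inside (rectangle m) x y → SameElbow (tile P x y) (tile Q x y))

infix 4 _⟶_

_⟶_ : BPD n → BPD n → Set
P ⟶ Q = ∃[ m ] Allowed m P × Result m P Q

{-# OPTIONS --safe #-}
module Submission where

open import Defs
open import Data.Bool.Base using (Bool; true; false; not; _∧_; _xor_; T)
open import Data.Bool.Properties as Bool using (∧-zeroʳ; xor-same)
open import Data.Empty using (⊥-elim)
open import Data.Fin.Base using (Fin; zero; suc; toℕ; fromℕ<)
open import Data.Fin.Permutation using (Permutation′; _⟨$⟩ʳ_)
open import Data.Fin.Properties as Fin using (toℕ<n; toℕ-fromℕ<; fromℕ<-toℕ; toℕ-injective)
open import Data.List.Base as List using (List; []; _∷_)
open import Data.List.Membership.Propositional renaming (_∈_ to _∈ₗ_) using ()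
open import Data.List.Relation.Unary.All as All using (All; []; _∷_)
open import Data.List.Relation.Unary.All.Properties using (map⁺; map⁻)
open import Data.List.Relation.Unary.Any using (here; there)
open import Data.Maybe.Base using (Maybe; just; nothing; is-just; map)
open import Data.Maybe.Properties using (just-injective; map-injective)
open import Data.Nat.Base using (ℕ; zero; suc; _+_; _⊓_; _⊔_; _≤_; _<_; _≤ᵇ_; z≤n; s≤s)
import Data.Nat.Properties as ℕ
open import Data.Product.Base using (_×_; _,_; proj₁; proj₂; ∃-syntax)
open import Data.Sum.Base as Sum using (_⊎_; inj₁; inj₂)
open import Data.Vec.Functional using (Vector; tail)
open import Function.Base using (_∘_; const)
open import Function.Bundles using (_⇔_; mk⇔; Equivalence)
open import Relation.Binary.Construct.Closure.ReflexiveTransitive using (Star; ε; _◅_; _◅◅_)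
open import Relation.Binary.Definitions using (tri<; tri≈; tri>)
open import Relation.Binary.PropositionalEquality
open import Relation.Nullary using (¬_; Dec; does; yes; no)
open import Relation.Nullary.Decidable using (dec-true; dec-false)
open import Relation.Unary using (_∈_)

-- At a non-elbow tile labels propagate through the operation
-- (l , b) ↦ (min , max), absent labels passing through.  It satisfies the
-- Yang–Baxter equation, so a strand running below a block of horizontal
-- and vertical pipes may be pushed through the block to its other side;
-- this is why a droop does not change ∂.  A K-theoretic droop makes two
-- crossing pipes cross a second time, and the second crossing has no
-- effect on labels that are already sorted.
--
-- Conversely, consider the first upward elbow (a , b) in reading order,
-- the nearest downward elbow (a , j) to its left, and the lowest row i
-- above a with a downward elbow (i , c) in the columns j < c ≤ b.  An
-- inverse droop (if c = b) removes the upward elbow, and an inverse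
-- K-theoretic droop of the first type (if c < b) moves (a , j) to (a , c),
-- which is closer to it.  When no upward elbow is left, the pipe of each
-- row carries the number of the column in which it turns, so the pipe
-- dream is Φ w.  Droops and K-theoretic droops of the first type suffice.

open Equivalence using (to; from)
open Rectangle using (i; a; j; b)

private
  variable
    n : ℕ

-- The three moves are one operation. In the rectangle spanned by the downward elbow (i , j) and a
-- lower right corner cell, pipes run along the upper and left sides and not along the other two;
-- the move exchanges the sides. The corner cell is blank for a droop and a downward elbow for a
-- K-theoretic one, whose upward elbow lies outside this smaller rectangle and stays put. So both
-- the results of moves and the inverse moves are obtained by toggling the edges on one closed path.
-- Invariance compares the labels of the two pipe dreams on every horizontal line, from the bottom
-- up. Inside the rectangle these labels differ, so a relation is carried upwards instead: turning
-- one strand to the right in each pipe dream yields the same labels. In the converse there are no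
-- upward elbows before (a , b), so a pipe that has appeared persists to the right in the rows above
-- and downwards in the columns; this excludes stray elbows from the rectangle. The row i exists
-- because otherwise the pipe leaving (a , b) upwards would run straight to the top boundary.

ascend : (A : ℕ → Set) → ∀ {l m} → l ≤ m → (∀ x → l ≤ x → x < m → A x → A (suc x)) → A l → A m
ascend A {m = zero}  z≤n f a = a
ascend A {l} {suc m} l≤m f a with l ℕ.≟ suc m
... | yes refl = a
... | no  l≢   = f m l≤ ℕ.≤-refl (ascend A l≤ (λ x l≤x x<m → f x l≤x (ℕ.m≤n⇒m≤1+n x<m)) a)
  where l≤ = ℕ.≤-pred (ℕ.≤∧≢⇒< l≤m l≢)

descend : (A : ℕ → Set) → ∀ {l m} → l ≤ m → (∀ x → l ≤ x → x < m → A (suc x) → A x) → A m → A l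
descend A {m = zero}  z≤n f a = a
descend A {l} {suc m} l≤m f a with l ℕ.≟ suc m
... | yes refl = a
... | no  l≢   = descend A l≤ (λ x l≤x x<m → f x l≤x (ℕ.m≤n⇒m≤1+n x<m)) (f m l≤ ℕ.≤-refl a)
  where l≤ = ℕ.≤-pred (ℕ.≤∧≢⇒< l≤m l≢)

-- Crossings of labelled pipes

Lab : Set
Lab = Maybe ℕ

-- A missing label passes through unaffected, so that cross also describes
-- blank, horizontal and vertical tiles.

cross : Lab → Lab → Lab × Lab
cross (just x) (just y) = just (x ⊓ y) , just (x ⊔ y)
cross (just x) nothing  = just x , nothing
cross nothing  b        = nothing , b

cross-nothing : ∀ l → cross l nothing ≡ (l , nothing)
cross-nothing nothing  = refl
cross-nothing (just _) = refl

cross-sorted : ∀ {x y} → x ≤ y → cross (just x) (just y) ≡ (just x , just y)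
cross-sorted x≤y = cong₂ (λ r t → just r , just t) (ℕ.m≤n⇒m⊓n≡m x≤y) (ℕ.m≤n⇒m⊔n≡n x≤y)

cross-unsorted : ∀ {x y} → y ≤ x → cross (just x) (just y) ≡ (just y , just x)
cross-unsorted y≤x = cong₂ (λ r t → just r , just t) (ℕ.m≥n⇒m⊓n≡n y≤x) (ℕ.m≥n⇒m⊔n≡m y≤x)

is-just-cross : ∀ l b → is-just (proj₁ (cross l b)) ≡ is-just l × is-just (proj₂ (cross l b)) ≡ is-just b
is-just-cross (just _) (just _) = refl , refl
is-just-cross (just _) nothing  = refl , refl
is-just-cross nothing  b        = refl , refl

-- Each side is the median of the three numbers, the label on the middle outlet of three mutually
-- crossing strands.
median : ∀ s z t → (s ⊔ z) ⊓ ((s ⊓ z) ⊔ t) ≡ (s ⊓ (z ⊔ t)) ⊔ (z ⊓ t)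
median s z t = begin
  (s ⊔ z) ⊓ ((s ⊓ z) ⊔ t)             ≡⟨ ℕ.⊓-distribˡ-⊔ (s ⊔ z) (s ⊓ z) t ⟩
  ((s ⊔ z) ⊓ (s ⊓ z)) ⊔ ((s ⊔ z) ⊓ t) ≡⟨ cong₂ _⊔_ (ℕ.m≥n⇒m⊓n≡n (ℕ.≤-trans (ℕ.m⊓n≤m s z) (ℕ.m≤m⊔n s z)))
                                                    (ℕ.⊓-distribʳ-⊔ t s z) ⟩
  (s ⊓ z) ⊔ ((s ⊓ t) ⊔ (z ⊓ t))       ≡⟨ ℕ.⊔-assoc (s ⊓ z) (s ⊓ t) (z ⊓ t) ⟨
  ((s ⊓ z) ⊔ (s ⊓ t)) ⊔ (z ⊓ t)       ≡⟨ cong (_⊔ (z ⊓ t)) (ℕ.⊓-distribˡ-⊔ s z t) ⟨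
  (s ⊓ (z ⊔ t)) ⊔ (z ⊓ t)             ∎
  where open ≡-Reasoning

⊔-absorb : ∀ s z t → (s ⊔ z) ⊔ ((s ⊓ z) ⊔ t) ≡ s ⊔ (z ⊔ t)
⊔-absorb s z t = begin
  (s ⊔ z) ⊔ ((s ⊓ z) ⊔ t) ≡⟨ ℕ.⊔-assoc (s ⊔ z) (s ⊓ z) t ⟨
  ((s ⊔ z) ⊔ (s ⊓ z)) ⊔ t ≡⟨ cong (_⊔ t) (ℕ.m≥n⇒m⊔n≡m (ℕ.≤-trans (ℕ.m⊓n≤m s z) (ℕ.m≤m⊔n s z))) ⟩
  (s ⊔ z) ⊔ t             ≡⟨ ℕ.⊔-assoc s z t ⟩
  s ⊔ (z ⊔ t)             ∎
  where open ≡-Reasoning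

⊓-absorb : ∀ s z t → (s ⊓ (z ⊔ t)) ⊓ (z ⊓ t) ≡ (s ⊓ z) ⊓ t
⊓-absorb s z t = begin
  (s ⊓ (z ⊔ t)) ⊓ (z ⊓ t) ≡⟨ ℕ.⊓-assoc s (z ⊔ t) (z ⊓ t) ⟩
  s ⊓ ((z ⊔ t) ⊓ (z ⊓ t)) ≡⟨ cong (s ⊓_) (ℕ.m≥n⇒m⊓n≡n (ℕ.≤-trans (ℕ.m⊓n≤m z t) (ℕ.m≤m⊔n z t))) ⟩
  s ⊓ (z ⊓ t)             ≡⟨ ℕ.⊓-assoc s z t ⟨
  (s ⊓ z) ⊓ t             ∎
  where open ≡-Reasoning

YangBaxter : (s z t : Lab) → Set
YangBaxter s z t =
  let s₁ , z₁ = cross s z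
      s₂ , t₁ = cross s₁ t
      z′ , t′ = cross z t
      s′ , t″ = cross s t′
      r  , u  = cross s′ z′
  in r ≡ s₂ × cross z₁ t₁ ≡ (u , t″)

-- In either order the three outlets receive the minimum, the median and the maximum of the labels.
-- If a label is missing, at most one genuine crossing remains and the two orders agree by
-- computation.
yangBaxter : ∀ s z t → YangBaxter s z t
yangBaxter nothing  nothing  t        = refl , refl
yangBaxter nothing  (just z) nothing  = refl , refl
yangBaxter nothing  (just z) (just t) = refl , refl
yangBaxter (just s) nothing  nothing  = refl , refl
yangBaxter (just s) nothing  (just t) = refl , refl
yangBaxter (just s) (just z) nothing  = refl , refl
yangBaxter (just s) (just z) (just t) =
  cong just (⊓-absorb s z t) ,
  cong₂ (λ u v → just u , just v) (median s z t) (⊔-absorb s z t)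

-- The labels s, entering from the left, pass successively over the
-- labels t lo, t (lo + 1), …, which come from below and leave as t′.

Pass : (lo hi : ℕ) (s t t′ : ℕ → Lab) → Set
Pass lo hi s t t′ = ∀ y → lo ≤ y → y < hi → cross (s y) (t y) ≡ (s (suc y) , t′ y)

pass-unique : ∀ {lo hi s s′ t t₁ t₂} → Pass lo hi s t t₁ → Pass lo hi s′ t t₂ → s lo ≡ s′ lo →
              ∀ y → lo ≤ y → y ≤ hi → s y ≡ s′ y
pass-unique {s = s} {s′} {t} f g q y lo≤y y≤hi =
  ascend (λ y → s y ≡ s′ y) lo≤y step q
  where
  step : ∀ x → _ ≤ x → x < y → s x ≡ s′ x → s (suc x) ≡ s′ (suc x)
  step x l x<y e = cong proj₁
    (trans (sym (f x l (ℕ.<-≤-trans x<y y≤hi))) (trans (cong (λ u → cross u (t x)) e) (g x l (ℕ.<-≤-trans x<y y≤hi))))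

pass-exists : ∀ lo l (t : ℕ → Lab) → ∃[ s ] ∃[ t′ ] s lo ≡ l × (∀ hi → Pass lo hi s t t′)
pass-exists zero l t = s , (λ y → proj₂ (cross (s y) (t y))) , refl , λ _ _ _ _ → refl
  where
  s : ℕ → Lab
  s zero    = l
  s (suc y) = proj₁ (cross (s y) (t y))
pass-exists (suc lo) l t with pass-exists lo l (t ∘ suc)
... | s , t′ , q , f = shift s , shift t′ , q , λ { hi (suc y) (s≤s l≤) (s≤s y<) → f _ y l≤ y< }
  where
  shift : (ℕ → Lab) → ℕ → Lab
  -- A `Pass` from `lo` on never reads earlier columns, so this label is arbitrary.
  shift f zero    = nothing
  shift f (suc y) = f y

-- Two strands passing over the same labels may cross before or after.

module Exchange {lo hi : ℕ} {s t t₁ z t′ s′ t″ : ℕ → Lab}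
  (lower₁ : Pass lo hi s t t₁) (lower₂ : Pass lo hi z t t′) (upper₂ : Pass lo hi s′ t′ t″)
  (start : s lo ≡ proj₁ (cross (s′ lo) (z lo))) where

  z₁ : ℕ → Lab
  z₁ y = proj₂ (cross (s′ y) (z y))

  private
    step : ∀ y → lo ≤ y → y < hi → s y ≡ proj₁ (cross (s′ y) (z y)) →
           s (suc y) ≡ proj₁ (cross (s′ (suc y)) (z (suc y))) ×
           cross (z₁ y) (t₁ y) ≡ (z₁ (suc y) , t″ y)
    step y l h e = trans (cong proj₁ (sym eq₁)) (trans (sym (proj₁ yb)) (cong proj₁ eq₄)) ,
                   trans (cong (cross (z₁ y)) (cong proj₂ (sym eq₁))) (trans (proj₂ yb) (cong₂ _,_ (cong proj₂ eq₄) (cong proj₂ eq₃)))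
      where
      yb = yangBaxter (s′ y) (z y) (t y)
      eq₁ : cross (proj₁ (cross (s′ y) (z y))) (t y) ≡ (s (suc y) , t₁ y)
      eq₁ = subst (λ u → cross u (t y) ≡ _) e (lower₁ y l h)
      eq₂ : cross (z y) (t y) ≡ (z (suc y) , t′ y)
      eq₂ = lower₂ y l h
      eq₃ : cross (s′ y) (proj₂ (cross (z y) (t y))) ≡ (s′ (suc y) , t″ y)
      eq₃ = trans (cong (cross (s′ y) ∘ proj₂) eq₂) (upper₂ y l h)
      eq₄ = cong₂ (λ p q → cross (proj₁ p) (proj₁ q)) eq₃ eq₂

  -- `yangBaxter` moves the crossing of the two strands one column to the right, with `t y` as the
  -- third strand.
  right-strand : ∀ y → lo ≤ y → y ≤ hi → s y ≡ proj₁ (cross (s′ y) (z y))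
  right-strand y l h = ascend (λ y → s y ≡ proj₁ (cross (s′ y) (z y))) l
    (λ x lo≤x x<y → proj₁ ∘ step x lo≤x (ℕ.<-≤-trans x<y h)) start

  upper₁ : Pass lo hi z₁ t₁ t″
  upper₁ y l h = proj₂ (step y l h (right-strand y l (ℕ.<⇒≤ h)))

-- Labellings

step : Maybe Elbow → Lab → Lab → Lab × Lab
step (just downward) l b = b , nothing
step (just upward)   l b = nothing , l
step nothing         l b = cross l b

-- left x y is the label on the left edge of cell (x , y) and top x y the
-- one on its top edge.

record Labelling (n : ℕ) (E : ℕ → ℕ → Maybe Elbow) : Set where
  field
    leftL topL : ℕ → ℕ → Lab
    rule   : ∀ x y → x < n → step (E x y) (leftL x y) (topL (suc x) y) ≡ (leftL x (suc y) , topL x y)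
    start  : ∀ x → x < n → leftL x 0 ≡ nothing
    base   : ∀ y → topL n y ≡ just y

  cell : ∀ {e} x y → x < n → E x y ≡ e → step e (leftL x y) (topL (suc x) y) ≡ (leftL x (suc y) , topL x y)
  cell x y x<n refl = rule x y x<n

-- Labels rise from the base, so the recursion computes the top row last. Columns are not bounded on
-- the right, which keeps side conditions on `y` out of `rule` and `base`.
labelling : ∀ n E → Labelling n E
labelling zero E = record
  { leftL = λ _ _ → nothing ; topL = λ _ → just
  ; rule = λ { _ _ () } ; start = λ { _ () } ; base = λ _ → refl }
labelling (suc n) E = record
  { leftL = λ { zero → l ; (suc x) → leftL x }
  ; topL  = λ { zero → t ; (suc x) → topL x }
  ; rule  = λ { zero y _ → refl ; (suc x) y (s≤s x<n) → rule x y x<n }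
  ; start = λ { zero _ → refl ; (suc x) (s≤s x<n) → start x x<n }
  ; base  = base }
  where
  open Labelling (labelling n (E ∘ suc))
  l t : ℕ → Lab
  l zero    = nothing
  l (suc y) = proj₁ (step (E 0 y) (l y) (topL 0 y))
  t y = proj₂ (step (E 0 y) (l y) (topL 0 y))

-- Labels in the rows of a droop

restrict : ∀ {lo hi lo′ hi′ s t t′} → lo ≤ lo′ → hi′ ≤ hi → Pass lo hi s t t′ → Pass lo′ hi′ s t t′
restrict l h f y lo≤y y<hi = f y (ℕ.≤-trans l lo≤y) (ℕ.<-≤-trans y<hi h)

under : ∀ {lo hi s t u t′} → (∀ y → lo ≤ y → y < hi → t y ≡ u y) → Pass lo hi s t t′ → Pass lo hi s u t′
under {s = s} e f y l h = trans (cong (cross (s y)) (sym (e y l h))) (f y l h)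

pass-unique′ : ∀ {lo hi s s′ t t₁ t₂} → Pass lo hi s t t₁ → Pass lo hi s′ t t₂ → s lo ≡ s′ lo →
               ∀ y → lo ≤ y → y < hi → t₁ y ≡ t₂ y
pass-unique′ {t = t} f g q y l h =
  cong proj₂ (trans (sym (f y l h)) (trans (cong (λ u → cross u (t y)) (pass-unique f g q y l (ℕ.<⇒≤ h))) (g y l h)))

pass-nothing : ∀ {lo hi s t t′} → Pass lo hi s t t′ → s lo ≡ nothing →
               (∀ y → lo ≤ y → y ≤ hi → s y ≡ nothing) × (∀ y → lo ≤ y → y < hi → t y ≡ t′ y)
pass-nothing f q = pass-unique f (λ _ _ _ → refl) q , λ y l h → sym (pass-unique′ f (λ _ _ _ → refl) q y l h)

pass-just : ∀ {lo hi s t t′} → Pass lo hi s t t′ → ∀ y → lo ≤ y → y ≤ hi → is-just (s y) ≡ is-just (s lo)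
pass-just {s = s} {t} f y l h = ascend (λ y → is-just (s y) ≡ is-just (s _)) l
  (λ x l x<y e → trans (cong (is-just ∘ proj₁) (sym (f x l (ℕ.<-≤-trans x<y h)))) (trans (proj₁ (is-just-cross (s x) (t x))) e)) refl

-- This is where the Demazure product differs from following pipes: two pipes that have crossed come
-- out sorted, and a second crossing returns their labels to the same positions.
cross-idem : ∀ {l b r t} → cross l b ≡ (r , t) → is-just b ≡ true → is-just r ≡ true → cross t r ≡ (r , t)
cross-idem {just x} {just y} refl _ _ = cross-unsorted (ℕ.≤-trans (ℕ.m⊓n≤m x y) (ℕ.m≤m⊔n x y))

-- The strand `s` leaves the larger label behind at each crossing: `z` becomes the maximum of `s`
-- and `z`, and `q` the maximum of `q` and what is left of `s`, which is at most that of `z`.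
cross-keeps-sorted : ∀ {s z q h z₁ r q₁} → cross s z ≡ (h , z₁) → cross h q ≡ (r , q₁) → cross z q ≡ (q , z) →
  is-just q ≡ true → is-just z ≡ true → cross z₁ q₁ ≡ (q₁ , z₁) × is-just q₁ ≡ true × is-just z₁ ≡ true
cross-keeps-sorted {nothing} {just v} {just q} refl refl e _ _ = e , refl , refl
cross-keeps-sorted {just s} {just v} {just q} refl refl e _ _ =
  cross-unsorted (ℕ.⊔-lub (ℕ.≤-trans (ℕ.m⊓n≤m s v) (ℕ.m≤m⊔n s v)) (ℕ.≤-trans q≤v (ℕ.m≤n⊔m s v))) , refl , refl
  where
  q≤v : q ≤ v
  q≤v = subst (_≤ v) (just-injective (cong proj₁ e)) (ℕ.m⊓n≤m v q)

-- p and q are the labels on a horizontal line in two pipe dreams.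
-- Turning the strand in column j of the first and the one in column c of
-- the second to the right, both yield the labels w.

record Drooped (j c b : ℕ) (p q : ℕ → Lab) : Set where
  field
    z z′ w   : ℕ → Lab
    z-start  : z (suc j) ≡ p j
    z-pass   : Pass (suc j) (suc b) z p w
    z′-start : z′ (suc c) ≡ q c
    z′-pass  : Pass (suc c) (suc b) z′ q w
    between  : ∀ y → suc j ≤ y → y < c → w y ≡ q y
    meet     : z (suc b) ≡ z′ (suc b)
    p-c      : p c ≡ nothing
    q-j      : q j ≡ nothing

module _ {j c b : ℕ} (j<c : j < c) (c≤b : c ≤ b) where

  private
    j<sb : j < suc b
    j<sb = ℕ.≤-trans j<c (ℕ.m≤n⇒m≤1+n c≤b)
    c<sb : c < suc b
    c<sb = s≤s c≤b

  -- Both rows are compared with one auxiliary strand `σ` running over the common labels `w`.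
  -- Sliding `σ` below `z` gives the row of the first pipe dream, sliding it below `z′` that of the
  -- second; the turned strands lie above the row afterwards.
  drooped-row : ∀ {h h′ p p₁ q q₁} → Pass j (suc b) h p p₁ → Pass j (suc b) h′ q q₁ → h j ≡ h′ j →
                Drooped j c b p q → h (suc b) ≡ h′ (suc b) × Drooped j c b p₁ q₁
  drooped-row {h} {h′} {p} {p₁} {q} {q₁} f g e D =
    trans (X₁.right-strand (suc b) j<sb ℕ.≤-refl)
      (trans (cong (λ u → proj₁ (cross (σ (suc b)) u)) meet) (sym (X₂.right-strand (suc b) c<sb ℕ.≤-refl))) ,
    record
      { z = X₁.z₁ ; z′ = X₂.z₁ ; w = w₁
      ; z-start  = trans (cong₂ (λ u v → proj₂ (cross u v)) σ-start z-start) (cong proj₂ (f j ℕ.≤-refl j<sb))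
      ; z-pass   = X₁.upper₁
      ; z′-start = trans (cong₂ (λ u v → proj₂ (cross u v)) σ-c z′-start) (cong proj₂ (g c (ℕ.<⇒≤ j<c) c<sb))
      ; z′-pass  = X₂.upper₁
      ; between  = λ y l y<c → sym (pass-unique′ h′-pass (σ-pass c) h′-start y l y<c)
      ; meet     = cong (λ u → proj₂ (cross (σ (suc b)) u)) meet
      ; p-c      = outgoing-nothing (f c (ℕ.<⇒≤ j<c) c<sb) p-c
      ; q-j      = outgoing-nothing (g j ℕ.≤-refl j<sb) q-j }
    where
    open Drooped D
    through : ∀ {l t r u} → cross l t ≡ (r , u) → t ≡ nothing → r ≡ l × u ≡ nothing
    through {l} eq refl = cong proj₁ (trans (sym eq) (cross-nothing l)) , cong proj₂ (trans (sym eq) (cross-nothing l))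
    outgoing-nothing : ∀ {l t r u} → cross l t ≡ (r , u) → t ≡ nothing → u ≡ nothing
    outgoing-nothing eq = proj₂ ∘ through eq
    ∃σ = pass-exists (suc j) (h j) w
    σ = proj₁ ∃σ
    w₁ = proj₁ (proj₂ ∃σ)
    σ-start = proj₁ (proj₂ (proj₂ ∃σ))
    σ-pass : ∀ hi → Pass (suc j) hi σ w w₁
    σ-pass = proj₂ (proj₂ (proj₂ ∃σ))
    w-c : w c ≡ nothing
    w-c = outgoing-nothing (z-pass c j<c c<sb) p-c
    h′-start : h′ (suc j) ≡ σ (suc j)
    h′-start = trans (proj₁ (through (g j ℕ.≤-refl j<sb) q-j)) (trans (sym e) (sym σ-start))
    h′-pass : Pass (suc j) c h′ w q₁
    h′-pass = under (λ y l y<c → sym (between y l y<c)) (restrict (ℕ.n≤1+n j) (ℕ.<⇒≤ c<sb) g)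
    -- The second exchange starts just after column `c`. There `σ` has met no label, so it still
    -- carries what `h′` brings into column `c`, where `h′` crosses the strand about to become `z′`.
    σ-c : σ (suc c) ≡ h′ c
    σ-c = trans (proj₁ (through (σ-pass (suc c) c j<c ℕ.≤-refl) w-c))
                (sym (pass-unique h′-pass (σ-pass c) h′-start c j<c ℕ.≤-refl))
    module X₁ = Exchange (restrict (ℕ.n≤1+n j) ℕ.≤-refl f) z-pass (σ-pass (suc b))
      (trans (cong proj₁ (sym (f j ℕ.≤-refl j<sb))) (cong₂ (λ u v → proj₁ (cross u v)) (sym σ-start) (sym z-start)))
    module X₂ = Exchange (restrict (ℕ.m≤n⇒m≤1+n (ℕ.<⇒≤ j<c)) ℕ.≤-refl g) z′-pass
      (restrict (ℕ.m≤n⇒m≤1+n j<c) ℕ.≤-refl (σ-pass (suc b)))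
      (trans (cong proj₁ (sym (g c (ℕ.<⇒≤ j<c) c<sb))) (cong₂ (λ u v → proj₁ (cross u v)) (sym σ-c) (sym z′-start)))

  -- In the top row of the rectangle the turns imagined in `Drooped` really take place: the downward
  -- elbows in columns `j` and `c` make `h` coincide with `z` and `h′` with `z′`.
  drooped-end : ∀ {h h′ p p₁ q q₁} →
    h (suc j) ≡ p j → p₁ j ≡ nothing → Pass (suc j) (suc b) h p p₁ →
    h′ (suc c) ≡ q c → q₁ c ≡ nothing → Pass j c h′ q q₁ → Pass (suc c) (suc b) h′ q q₁ →
    h′ j ≡ nothing → Drooped j c b p q →
    h (suc b) ≡ h′ (suc b) × (∀ y → j ≤ y → y ≤ b → p₁ y ≡ q₁ y)
  drooped-end {h} {h′} {p} {p₁} {q} {q₁} h-j p₁-j f h′-c q₁-c g₁ g₂ h′-j D =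
    trans (pass-unique f z-pass h-z (suc b) j<sb ℕ.≤-refl)
      (trans meet (pass-unique z′-pass g₂ z′-h′ (suc b) c<sb ℕ.≤-refl)) ,
    tops
    where
    open Drooped D
    h-z = trans h-j (sym z-start)
    z′-h′ = trans z′-start (sym h′-c)
    p₁-w : ∀ y → suc j ≤ y → y < suc b → p₁ y ≡ w y
    p₁-w = pass-unique′ f z-pass h-z
    tops : ∀ y → j ≤ y → y ≤ b → p₁ y ≡ q₁ y
    tops y j≤y y≤b with ℕ.<-cmp y c
    ... | tri> _ _ c<y = trans (p₁-w y (ℕ.≤-trans j<c (ℕ.<⇒≤ c<y)) (s≤s y≤b)) (pass-unique′ z′-pass g₂ z′-h′ y c<y (s≤s y≤b))
    ... | tri≈ _ refl _ = trans (p₁-w y j<c (s≤s y≤b)) (trans w-c (sym q₁-c))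
      where
      w-c : w y ≡ nothing
      w-c = cong proj₂ (trans (sym (z-pass y j<c (s≤s y≤b))) (trans (cong (cross (z y)) p-c) (cross-nothing (z y))))
    ... | tri< y<c _ _ with j ℕ.≟ y
    ...   | yes refl = trans p₁-j (trans (sym q-j) (proj₂ (pass-nothing g₁ h′-j) y ℕ.≤-refl y<c))
    ...   | no  j≢y  = trans (p₁-w y j<y (s≤s y≤b)) (trans (between y j<y y<c) (proj₂ (pass-nothing g₁ h′-j) y j≤y y<c))
      where j<y = ℕ.≤∧≢⇒< j≤y j≢y

-- The common base of a droop and a droop of the second K-theoretic type.

drooped-single : ∀ {j b p q z w} → j < b → z (suc j) ≡ p j → Pass (suc j) b z p w → p b ≡ nothing → q j ≡ nothing →
  (∀ y → suc j ≤ y → y < b → w y ≡ q y) → z b ≡ q b → Drooped j b b p q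
drooped-single {j} {b} {p} {q} {z} j<b st f p-b q-j w-q z-b = record
  { z = z₁ ; z′ = const (q b) ; w = w₁
  ; z-start = z₁-start ; z-pass = g (suc b)
  ; z′-start = refl ; z′-pass = λ { y b<y (s≤s y≤b) → ⊥-elim (ℕ.<⇒≱ b<y y≤b) }
  ; between = λ y l h → trans (pass-unique′ (g b) f (trans z₁-start (sym st)) y l h) (w-q y l h)
  ; meet = trans (cong proj₁ (trans (sym (g (suc b) b j<b ℕ.≤-refl)) (trans (cong (cross (z₁ b)) p-b) (cross-nothing (z₁ b)))))
      (trans (pass-unique (g b) f (trans z₁-start (sym st)) b j<b ℕ.≤-refl) z-b)
  ; p-c = p-b ; q-j = q-j }
  where
  ex = pass-exists (suc j) (p j) p
  z₁ = proj₁ ex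
  w₁ = proj₁ (proj₂ ex)
  z₁-start = proj₁ (proj₂ (proj₂ ex))
  g : ∀ hi → Pass (suc j) hi z₁ p w₁
  g = proj₂ (proj₂ (proj₂ ex))

-- The first pipe dream has no label in this part of the row. In the second, `h′` is the strand of
-- column `j` turned to the right, hence serves as `z`, and the upward elbow sends it into column
-- `b`.
droop-row : ∀ {j b h h′ p p₁ q q₁} → j < b → (∀ y → j ≤ y → y ≤ b → p y ≡ q y) → h j ≡ nothing →
  Pass j (suc b) h p p₁ →
  h′ (suc j) ≡ q j → q₁ j ≡ nothing → Pass (suc j) b h′ q q₁ →
  q b ≡ nothing → q₁ b ≡ h′ b → h′ (suc b) ≡ nothing →
  h (suc b) ≡ h′ (suc b) × Drooped j b b p₁ q₁
droop-row {j} {b} {h} {h′} {p} {p₁} {q} {q₁} j<b p-q h-j f h′-j q₁-j g q-b q₁-b h′-b =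
  trans (proj₁ thru (suc b) (ℕ.m≤n⇒m≤1+n (ℕ.<⇒≤ j<b)) ℕ.≤-refl) (sym h′-b) ,
  drooped-single {z = h′} {w = q₁} j<b (trans h′-j (q-p₁ j ℕ.≤-refl (s≤s (ℕ.<⇒≤ j<b))))
    (under (λ y l y<b → q-p₁ y (ℕ.<⇒≤ l) (ℕ.m≤n⇒m≤1+n y<b)) g)
    (trans (sym (q-p₁ b (ℕ.<⇒≤ j<b) ℕ.≤-refl)) q-b) q₁-j (λ _ _ _ → refl) (sym q₁-b)
  where
  thru = pass-nothing f h-j
  q-p₁ : ∀ y → j ≤ y → y < suc b → q y ≡ p₁ y
  q-p₁ y l y< = trans (sym (p-q y l (ℕ.≤-pred y<))) (proj₂ thru y l y<)

-- In the first pipe dream the strand `z` of column `j` meets the pipe `h` only in column `b`. In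
-- the second the two cross already at column `c` of this row, and `z′` meets column `b` as a second
-- crossing. An exchange carries the crossing at `c` to column `b`, and `cross-idem` disposes of the
-- repetition.
Kdroop₁-row : ∀ {j c b h h′ p p₁ q q₁} → j < c → c < b → (∀ y → j ≤ y → y ≤ b → p y ≡ q y) → h j ≡ nothing →
  Pass j c h p p₁ → h (suc c) ≡ p c → p₁ c ≡ nothing → Pass (suc c) b h p p₁ →
  p₁ b ≡ h b → h (suc b) ≡ nothing → is-just (h b) ≡ true →
  h′ (suc j) ≡ q j → q₁ j ≡ nothing → Pass (suc j) b h′ q q₁ →
  q₁ b ≡ h′ b → h′ (suc b) ≡ nothing → is-just (h′ b) ≡ true →
  h (suc b) ≡ h′ (suc b) × Drooped j c b p₁ q₁
Kdroop₁-row {j} {c} {b} {h} {h′} {p} {p₁} {q} {q₁} j<c c<b p-q h-j f₁ h-c p₁-c f₂ p₁-b h-sb h-b! h′-j q₁-j g q₁-b h′-sb h′-b! =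
  trans h-sb (sym h′-sb) ,
  record
    { z = z ; z′ = z′ ; w = w
    ; z-start = z-start ; z-pass = z-pass (suc b)
    ; z′-start = z′-start ; z′-pass = z′-pass
    ; between = between
    ; meet = trans (cong proj₁ at-b) (cong proj₁ (sym at-b′))
    ; p-c = p₁-c ; q-j = q₁-j }
  where
  ex = pass-exists (suc j) (p₁ j) p₁
  z = proj₁ ex
  w = proj₁ (proj₂ ex)
  z-start = proj₁ (proj₂ (proj₂ ex))
  z-pass : ∀ hi → Pass (suc j) hi z p₁ w
  z-pass = proj₂ (proj₂ (proj₂ ex))
  p₁-q : ∀ y → j ≤ y → y < c → p₁ y ≡ q y
  p₁-q y l y<c = trans (sym (proj₂ (pass-nothing f₁ h-j) y l y<c)) (p-q y l (ℕ.<⇒≤ (ℕ.<-trans y<c c<b)))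
  z-h′ : z (suc j) ≡ h′ (suc j)
  z-h′ = trans z-start (trans (p₁-q j ℕ.≤-refl j<c) (sym h′-j))
  z-pass-q : Pass (suc j) c z q w
  z-pass-q = under (λ y l y<c → p₁-q y (ℕ.<⇒≤ l) y<c) (z-pass c)
  g-c : Pass (suc j) c h′ q q₁
  g-c = restrict ℕ.≤-refl (ℕ.<⇒≤ c<b) g
  between : ∀ y → suc j ≤ y → y < c → w y ≡ q₁ y
  between = pass-unique′ z-pass-q g-c z-h′
  z-sc : z (suc c) ≡ h′ c
  z-sc = trans (cong proj₁ (trans (sym (z-pass (suc c) c j<c ℕ.≤-refl)) (trans (cong (cross (z c)) p₁-c) (cross-nothing (z c)))))
               (pass-unique z-pass-q g-c z-h′ c j<c ℕ.≤-refl)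
  at-c : cross (z (suc c)) (h (suc c)) ≡ (h′ (suc c) , q₁ c)
  at-c = trans (cong₂ cross z-sc (trans h-c (p-q c (ℕ.<⇒≤ j<c) (ℕ.<⇒≤ c<b)))) (g c j<c c<b)
  module X = Exchange (restrict (ℕ.m≤n⇒m≤1+n j<c) ℕ.≤-refl g)
    (under (λ y l y<b → p-q y (ℕ.≤-trans (ℕ.<⇒≤ j<c) (ℕ.<⇒≤ l)) (ℕ.<⇒≤ y<b)) f₂)
    (restrict (ℕ.m≤n⇒m≤1+n j<c) ℕ.≤-refl (z-pass b)) (sym (cong proj₁ at-c))
  ex′ = pass-exists (suc c) (q₁ c) q₁
  z′ = proj₁ ex′
  w′ = proj₁ (proj₂ ex′)
  z′-start = proj₁ (proj₂ (proj₂ ex′))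
  z′-pass₀ : ∀ hi → Pass (suc c) hi z′ q₁ w′
  z′-pass₀ = proj₂ (proj₂ (proj₂ ex′))
  z′-z₁ : z′ (suc c) ≡ X.z₁ (suc c)
  z′-z₁ = trans z′-start (sym (cong proj₂ at-c))
  at-b : (z (suc b) , w b) ≡ (h′ b , z′ b)
  at-b = trans (sym (z-pass (suc b) b (ℕ.<-trans j<c c<b) ℕ.≤-refl))
         (trans (cong (cross (z b)) p₁-b)
         (cong₂ _,_ (sym (X.right-strand b c<b ℕ.≤-refl)) (sym (pass-unique (z′-pass₀ b) X.upper₁ z′-z₁ b c<b ℕ.≤-refl))))
  -- The repeated crossing: its inputs are the outputs of the crossing in `at-b`, in sorted
  -- position.
  at-b′ : (z′ (suc b) , w′ b) ≡ (h′ b , z′ b)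
  at-b′ = trans (sym (z′-pass₀ (suc b) b c<b ℕ.≤-refl))
          (trans (cong (cross (z′ b)) q₁-b)
          (cross-idem (trans (cong (cross (z b)) (sym p₁-b)) (trans (z-pass (suc b) b (ℕ.<-trans j<c c<b) ℕ.≤-refl) at-b)) h-b! h′-b!))
  w-w′ : ∀ y → suc c ≤ y → y < suc b → w′ y ≡ w y
  w-w′ y l y<sb with y ℕ.≟ b
  ... | yes refl = trans (cong proj₂ at-b′) (cong proj₂ (sym at-b))
  ... | no  y≢b  = pass-unique′ (z′-pass₀ b) X.upper₁ z′-z₁ y l (ℕ.≤∧≢⇒< (ℕ.≤-pred y<sb) y≢b)
  z′-pass : Pass (suc c) (suc b) z′ q₁ w
  z′-pass y l y<sb = trans (z′-pass₀ (suc b) y l y<sb) (cong (z′ (suc y) ,_) (w-w′ y l y<sb))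

-- The strand of column j, turned to the right, meets the strand of
-- column b without having to be sorted.

record Sorted (j b : ℕ) (p : ℕ → Lab) : Set where
  field
    z w     : ℕ → Lab
    z-start : z (suc j) ≡ p j
    z-pass  : Pass (suc j) b z p w
    sorted  : cross (z b) (p b) ≡ (p b , z b)
    p-b!    : is-just (p b) ≡ true
    z-b!    : is-just (z b) ≡ true

-- The pipe of the row crosses column `j` and later goes up in column `b`. Moving that crossing from
-- column `j` to column `b` by an exchange exhibits the two labels in question as the outputs of one
-- crossing.
sorted-base : ∀ {j b h p p₁} → j < b → Pass j b h p p₁ → p₁ b ≡ h b → is-just (h b) ≡ true → is-just (p j) ≡ true →
              Sorted j b p₁
sorted-base {j} {b} {h} {p} {p₁} j<b f p₁-b h-b! p-j! = record
  { z = X.z₁ ; w = _ ; z-start = cong proj₂ at-j ; z-pass = X.upper₁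
  ; sorted = subst (λ u → cross (X.z₁ b) u ≡ (u , X.z₁ b)) (sym p₁-b) (cross-idem at-b z-b! h-b!)
  ; p-b! = trans (cong is-just p₁-b) h-b!
  ; z-b! = trans (proj₂ (is-just-cross (σ b) (z b))) z-b! }
  where
  ex = pass-exists (suc j) (p j) p
  z = proj₁ ex
  ex′ = pass-exists (suc j) (h j) (proj₁ (proj₂ ex))
  σ = proj₁ ex′
  z-start = proj₁ (proj₂ (proj₂ ex))
  z-b! = trans (pass-just (proj₂ (proj₂ (proj₂ ex)) b) b j<b ℕ.≤-refl) (trans (cong is-just z-start) p-j!)
  at-j = trans (cong₂ cross (proj₁ (proj₂ (proj₂ ex′))) z-start) (f j ℕ.≤-refl j<b)
  module X = Exchange (restrict (ℕ.n≤1+n j) ℕ.≤-refl f) (proj₂ (proj₂ (proj₂ ex)) b) (proj₂ (proj₂ (proj₂ ex′)) b)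
    (sym (cong proj₁ at-j))
  at-b : cross (σ b) (z b) ≡ (h b , X.z₁ b)
  at-b = cong (_, X.z₁ b) (sym (X.right-strand b j<b ℕ.≤-refl))

sorted-row : ∀ {j b h p p₁} → j < b → Pass j (suc b) h p p₁ → Sorted j b p → Sorted j b p₁
sorted-row {j} {b} {h} {p} {p₁} j<b f S = record
  { z = X.z₁ ; w = _ ; z-start = cong proj₂ at-j ; z-pass = X.upper₁
  ; sorted = proj₁ keep ; p-b! = proj₁ (proj₂ keep) ; z-b! = proj₂ (proj₂ keep) }
  where
  open Sorted S
  ex′ = pass-exists (suc j) (h j) w
  σ = proj₁ ex′
  at-j = trans (cong₂ cross (proj₁ (proj₂ (proj₂ ex′))) z-start) (f j ℕ.≤-refl (ℕ.m≤n⇒m≤1+n j<b))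
  module X = Exchange (restrict (ℕ.n≤1+n j) (ℕ.n≤1+n b) f) z-pass (proj₂ (proj₂ (proj₂ ex′)) b)
    (sym (cong proj₁ at-j))
  keep = cross-keeps-sorted {s = σ b} (cong (_, X.z₁ b) (sym (X.right-strand b j<b ℕ.≤-refl)))
    (f b (ℕ.<⇒≤ j<b) ℕ.≤-refl) sorted p-b! z-b!

-- The second pipe dream turns column `j` to the right here, making it cross column `b`. By `Sorted`
-- this crossing lets the label of column `b` leave to the right, as the downward elbow of the first
-- pipe dream does, and sends the label of column `j` upwards.
Kdroop₂-row : ∀ {j b h h′ p p₁ q q₁} → j < b → (∀ y → j ≤ y → y ≤ b → p y ≡ q y) → h j ≡ nothing →
  Pass j b h p p₁ → h (suc b) ≡ p b → p₁ b ≡ nothing →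
  h′ (suc j) ≡ q j → q₁ j ≡ nothing → Pass (suc j) (suc b) h′ q q₁ → Sorted j b p →
  h (suc b) ≡ h′ (suc b) × Drooped j b b p₁ q₁
Kdroop₂-row {j} {b} {h} {h′} {p} {p₁} {q} {q₁} j<b p-q h-j f h-b p₁-b h′-j q₁-j g S =
  trans h-b (cong proj₁ (sym at-b)) ,
  drooped-single {z = z} {w = w} j<b (trans z-start (p-p₁ j ℕ.≤-refl j<b))
    (under (λ y l → p-p₁ y (ℕ.<⇒≤ l)) z-pass) p₁-b q₁-j
    (pass-unique′ z-pass g-b z-h′) (cong proj₂ (sym at-b))
  where
  open Sorted S
  p-p₁ = proj₂ (pass-nothing f h-j)
  g-b : Pass (suc j) b h′ p q₁
  g-b = under (λ y l y<b → sym (p-q y (ℕ.<⇒≤ l) (ℕ.<⇒≤ y<b))) (restrict ℕ.≤-refl (ℕ.n≤1+n b) g)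
  z-h′ = trans z-start (trans (p-q j ℕ.≤-refl (ℕ.<⇒≤ j<b)) (sym h′-j))
  at-b : (h′ (suc b) , q₁ b) ≡ (p b , z b)
  at-b = trans (sym (g b j<b ℕ.≤-refl))
    (trans (cong₂ cross (sym (pass-unique z-pass g-b z-h′ b j<b ℕ.≤-refl)) (sym (p-q b (ℕ.<⇒≤ j<b) ℕ.≤-refl))) sorted)

-- Tilings indexed by natural numbers

elbowOf : Tile → Maybe Elbow
elbowOf (elbow e)  = just e
elbowOf crossing   = nothing
elbowOf blank      = nothing
elbowOf horizontal = nothing
elbowOf vertical   = nothing

-- The tiling continued by horizontal pipes to the right of the grid and
-- by vertical pipes below it.

extend : BPD n → ℕ → ℕ → Tile
extend {n} P x y with x ℕ.<? n | y ℕ.<? n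
... | yes x<n | yes y<n = tile P (fromℕ< x<n) (fromℕ< y<n)
... | yes _   | no  _   = horizontal
... | no  _   | yes _   = vertical
... | no  _   | no  _   = blank

extend-toℕ : (P : BPD n) → ∀ i j → extend P (toℕ i) (toℕ j) ≡ tile P i j
extend-toℕ {n} P i j with toℕ i ℕ.<? n | toℕ j ℕ.<? n
... | yes p  | yes q  = cong₂ (tile P) (fromℕ<-toℕ i p) (fromℕ<-toℕ j q)
... | yes _  | no j≮n = ⊥-elim (j≮n (toℕ<n j))
... | no i≮n | _      = ⊥-elim (i≮n (toℕ<n i))

extend-inside : (P : BPD n) → ∀ {x y} (p : x < n) (q : y < n) → extend P x y ≡ tile P (fromℕ< p) (fromℕ< q)
extend-inside P p q =
  trans (cong₂ (extend P) (sym (toℕ-fromℕ< p)) (sym (toℕ-fromℕ< q))) (extend-toℕ P (fromℕ< p) (fromℕ< q))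

extend-cong : (P Q : BPD n) → ∀ x y → (∀ i j → x ≡ toℕ i → y ≡ toℕ j → elbowOf (tile P i j) ≡ elbowOf (tile Q i j)) →
              elbowOf (extend P x y) ≡ elbowOf (extend Q x y)
extend-cong {n} P Q x y f with x ℕ.<? n | y ℕ.<? n
... | yes p | yes q = f _ _ (sym (toℕ-fromℕ< p)) (sym (toℕ-fromℕ< q))
... | yes _ | no  _ = refl
... | no  _ | yes _ = refl
... | no  _ | no  _ = refl

module Edges (P : BPD n) where

  right-left : ∀ x y → right (extend P x y) ≡ left (extend P x (suc y))
  right-left x y with x ℕ.<? n | y ℕ.<? n | suc y ℕ.<? n
  ... | yes p | yes q | yes r =
    left-right P (fromℕ< p) (trans (toℕ-fromℕ< r) (cong suc (sym (toℕ-fromℕ< q))))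
  ... | yes p | yes q | no ¬r =
    right-boundary P _ _ (trans (cong suc (toℕ-fromℕ< q)) (ℕ.≤-antisym q (ℕ.≮⇒≥ ¬r)))
  ... | yes p | no ¬q | yes r = ⊥-elim (¬q (ℕ.<-trans (ℕ.n<1+n y) r))
  ... | yes p | no _  | no  _ = refl
  ... | no  _ | yes _ | yes _ = refl
  ... | no  _ | yes _ | no  _ = refl
  ... | no  _ | no  _ | yes _ = refl
  ... | no  _ | no  _ | no  _ = refl

  bottom-top : ∀ x y → bottom (extend P x y) ≡ top (extend P (suc x) y)
  bottom-top x y with y ℕ.<? n | x ℕ.<? n | suc x ℕ.<? n
  ... | yes p | yes q | yes r =
    top-bottom P (fromℕ< p) (trans (toℕ-fromℕ< r) (cong suc (sym (toℕ-fromℕ< q))))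
  ... | yes p | yes q | no ¬r =
    bottom-boundary P _ _ (trans (cong suc (toℕ-fromℕ< q)) (ℕ.≤-antisym q (ℕ.≮⇒≥ ¬r)))
  ... | yes p | no ¬q | yes r = ⊥-elim (¬q (ℕ.<-trans (ℕ.n<1+n x) r))
  ... | yes p | no _  | no  _ = refl
  ... | no  _ | yes _ | yes _ = refl
  ... | no  _ | yes _ | no  _ = refl
  ... | no  _ | no  _ | yes _ = refl
  ... | no  _ | no  _ | no  _ = refl

  left-first : ∀ x → left (extend P x 0) ≡ false
  left-first x with x ℕ.<? n | 0 ℕ.<? n
  ... | yes p | yes q = left-boundary P _ _ (toℕ-fromℕ< q)
  ... | yes p | no ¬q = ⊥-elim (¬q (ℕ.≤-trans (s≤s z≤n) p))
  ... | no  _ | yes _ = refl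
  ... | no  _ | no  _ = refl

  top-first : ∀ y → top (extend P 0 y) ≡ false
  top-first y with 0 ℕ.<? n | y ℕ.<? n
  ... | yes p | yes q = top-boundary P _ _ (toℕ-fromℕ< p)
  ... | no ¬p | yes q = ⊥-elim (¬p (ℕ.≤-trans (s≤s z≤n) q))
  ... | yes _ | no  _ = refl
  ... | no  _ | no  _ = refl

  left-last : ∀ {x} → x < n → left (extend P x n) ≡ true
  left-last {x} x<n with x ℕ.<? n | n ℕ.<? n
  ... | _     | yes n<n = ⊥-elim (ℕ.<-irrefl refl n<n)
  ... | yes _ | no _    = refl
  ... | no ¬p | no _    = ⊥-elim (¬p x<n)

  top-last : ∀ {y} → y < n → top (extend P n y) ≡ true
  top-last {y} y<n with n ℕ.<? n | y ℕ.<? n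
  ... | yes n<n | _     = ⊥-elim (ℕ.<-irrefl refl n<n)
  ... | no _    | yes _ = refl
  ... | no _    | no ¬p = ⊥-elim (¬p y<n)

-- Labels on the pipes and the Demazure product

elbows : BPD n → ℕ → ℕ → Maybe Elbow
elbows P x y = elbowOf (extend P x y)

step-is-just : ∀ t l b → is-just l ≡ left t → is-just b ≡ bottom t →
  is-just (proj₁ (step (elbowOf t) l b)) ≡ right t × is-just (proj₂ (step (elbowOf t) l b)) ≡ top t
step-is-just (elbow downward) l b p q = q , refl
step-is-just (elbow upward)   l b p q = refl , p
step-is-just crossing   l b p q = trans (proj₁ (is-just-cross l b)) p , trans (proj₂ (is-just-cross l b)) q
step-is-just blank      l b p q = trans (proj₁ (is-just-cross l b)) p , trans (proj₂ (is-just-cross l b)) q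
step-is-just horizontal l b p q = trans (proj₁ (is-just-cross l b)) p , trans (proj₂ (is-just-cross l b)) q
step-is-just vertical   l b p q = trans (proj₁ (is-just-cross l b)) p , trans (proj₂ (is-just-cross l b)) q

is-nothing : ∀ {l : Lab} → is-just l ≡ false → l ≡ nothing
is-nothing {nothing} _ = refl

map₂ : Label n × Label n → Lab × Lab
map₂ (r , t) = map toℕ r , map toℕ t

-- The two rules disagree on labels that do not fit the tile: `propagate blank` discards what
-- `cross` passes on. The conditions on presence exclude this.
propagate-step : ∀ t (l b : Label n) → is-just (map toℕ l) ≡ left t → is-just (map toℕ b) ≡ bottom t →
  map₂ (propagate t l b) ≡ step (elbowOf t) (map toℕ l) (map toℕ b)
propagate-step (elbow downward) l b p q = refl
propagate-step (elbow upward)   l b p q = refl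
propagate-step crossing (just x) (just y) p q with toℕ x ≤ᵇ toℕ y in eq
... | true  = sym (cross-sorted (ℕ.≤ᵇ⇒≤ _ _ (subst T (sym eq) _)))
... | false = sym (cross-unsorted (ℕ.≰⇒≥ (subst T eq ∘ ℕ.≤⇒≤ᵇ)))
propagate-step blank      nothing  nothing  p q = refl
propagate-step horizontal (just _) nothing  p q = refl
propagate-step vertical   nothing  (just _) p q = refl

propagateRow-step : ∀ {m} (ts : Vector Tile m) (l : Label n) (bs : Vector (Label n) m) (h b v : ℕ → Lab) →
  (∀ j → step (elbowOf (ts j)) (h (toℕ j)) (b (toℕ j)) ≡ (h (suc (toℕ j)) , v (toℕ j))) →
  (∀ j → is-just (h (toℕ j)) ≡ left (ts j)) → (∀ j → is-just (b (toℕ j)) ≡ bottom (ts j)) →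
  map toℕ l ≡ h 0 → (∀ j → map toℕ (bs j) ≡ b (toℕ j)) →
  map toℕ (proj₁ (propagateRow ts l bs)) ≡ h m × (∀ j → map toℕ (proj₂ (propagateRow ts l bs) j) ≡ v (toℕ j))
propagateRow-step {m = zero}  ts l bs h b v rule hl bl l-h bs-b = l-h , λ ()
propagateRow-step {m = suc m} ts l bs h b v rule hl bl l-h bs-b =
  proj₁ rest , λ { zero → cong proj₂ first ; (suc j) → proj₂ rest j }
  where
  first : map₂ (propagate (ts zero) l (bs zero)) ≡ (h 1 , v 0)
  first = trans (propagate-step (ts zero) l (bs zero) (trans (cong is-just l-h) (hl zero)) (trans (cong is-just (bs-b zero)) (bl zero)))
         (trans (cong₂ (step (elbowOf (ts zero))) l-h (bs-b zero)) (rule zero))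
  rest = propagateRow-step (tail ts) (proj₁ (propagate (ts zero) l (bs zero))) (tail bs) (h ∘ suc) (b ∘ suc) (v ∘ suc)
    (rule ∘ suc) (hl ∘ suc) (bl ∘ suc) (cong proj₁ first) (bs-b ∘ suc)

propagateRows-step : ∀ {k m} (ts : Vector (Vector Tile m) k) (bs : Vector (Label n) m) (h v : ℕ → ℕ → Lab) →
  (∀ i j → step (elbowOf (ts i j)) (h (toℕ i) (toℕ j)) (v (suc (toℕ i)) (toℕ j)) ≡ (h (toℕ i) (suc (toℕ j)) , v (toℕ i) (toℕ j))) →
  (∀ i j → is-just (h (toℕ i) (toℕ j)) ≡ left (ts i j)) → (∀ i j → is-just (v (suc (toℕ i)) (toℕ j)) ≡ bottom (ts i j)) →
  (∀ (i : Fin k) → h (toℕ i) 0 ≡ nothing) → (∀ j → map toℕ (bs j) ≡ v k (toℕ j)) →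
  (∀ i → map toℕ (proj₁ (propagateRows ts bs) i) ≡ h (toℕ i) m) × (∀ j → map toℕ (proj₂ (propagateRows ts bs) j) ≡ v 0 (toℕ j))
propagateRows-step {k = zero}  ts bs h v rule hl vl h0 bs-v = (λ ()) , bs-v
propagateRows-step {k = suc k} ts bs h v rule hl vl h0 bs-v =
  (λ { zero → proj₁ row ; (suc i) → proj₁ rest i }) , proj₂ row
  where
  rest = propagateRows-step (tail ts) bs (h ∘ suc) (v ∘ suc) (rule ∘ suc) (hl ∘ suc) (vl ∘ suc) (h0 ∘ suc) bs-v
  row = propagateRow-step (ts zero) nothing (proj₂ (propagateRows (tail ts) bs)) (h 0) (v 1) (v 0)
    (rule zero) (hl zero) (vl zero) (sym (h0 zero)) (proj₂ rest)

module Labels (P : BPD n) where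

  open Edges P
  open Labelling (labelling n (elbows P)) public

  private
    row : ∀ {x} → x < n → (∀ y → y < n → is-just (topL (suc x) y) ≡ bottom (extend P x y)) →
          ∀ y → y ≤ n → is-just (leftL x y) ≡ left (extend P x y)
    row x<n f zero    _   = trans (cong is-just (start _ x<n)) (sym (left-first _))
    row {x} x<n f (suc y) y<n = trans (cong (is-just ∘ proj₁) (sym (rule x y x<n)))
      (trans (proj₁ (step-is-just (extend P x y) _ _ (row x<n f y (ℕ.<⇒≤ y<n)) (f y y<n))) (right-left x y))

  top-is-just : ∀ {x} → x ≤ n → ∀ y → y < n → is-just (topL x y) ≡ top (extend P x y)
  top-is-just x≤n = descend (λ x → ∀ y → y < n → is-just (topL x y) ≡ top (extend P x y)) x≤n
    (λ x _ x<n f y y<n →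
      let g = λ y y<n → trans (f y y<n) (sym (bottom-top x y))
      in trans (cong (is-just ∘ proj₂) (sym (rule x y x<n)))
         (proj₂ (step-is-just (extend P x y) _ _ (row x<n g y (ℕ.<⇒≤ y<n)) (g y y<n))))
    (λ y y<n → trans (cong is-just (base y)) (sym (top-last y<n)))

  bottom-is-just : ∀ {x y} → x < n → y < n → is-just (topL (suc x) y) ≡ bottom (extend P x y)
  bottom-is-just x<n y<n = trans (top-is-just x<n _ y<n) (sym (bottom-top _ _))

  left-is-just : ∀ {x y} → x < n → y ≤ n → is-just (leftL x y) ≡ left (extend P x y)
  left-is-just x<n = row x<n (λ y → bottom-is-just x<n) _

  ∂-left : ∀ i → map toℕ (∂ P i) ≡ leftL (toℕ i) n
  ∂-left = proj₁ (propagateRows-step (tile P) just leftL topL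
    (λ i j → cell (toℕ i) (toℕ j) (toℕ<n i) (cong elbowOf (extend-toℕ P i j)))
    (λ i j → trans (left-is-just (toℕ<n i) (ℕ.<⇒≤ (toℕ<n j))) (cong left (extend-toℕ P i j)))
    (λ i j → trans (bottom-is-just (toℕ<n i) (toℕ<n j)) (cong bottom (extend-toℕ P i j)))
    (λ i → start _ (toℕ<n i)) (λ j → sym (base _)))

  pass : ∀ {x lo hi} → x < n → (∀ y → lo ≤ y → y < hi → elbows P x y ≡ nothing) →
         Pass lo hi (leftL x) (topL (suc x)) (topL x)
  pass x<n f y l h = cell _ y x<n (f y l h)

  at-downward : ∀ {x y} → x < n → y < n → elbows P x y ≡ just downward →
                leftL x (suc y) ≡ topL (suc x) y × topL x y ≡ nothing × leftL x y ≡ nothing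
  at-downward {x} {y} x<n y<n e =
    cong proj₁ (sym r) , cong proj₂ (sym r) , is-nothing (trans (left-is-just x<n (ℕ.<⇒≤ y<n)) (left-downward _ e))
    where
    r = cell x y x<n e
    left-downward : ∀ t → elbowOf t ≡ just downward → left t ≡ false
    left-downward (elbow downward) _ = refl

  at-upward : ∀ {x y} → x < n → y < n → elbows P x y ≡ just upward →
              topL x y ≡ leftL x y × leftL x (suc y) ≡ nothing × topL (suc x) y ≡ nothing × is-just (leftL x y) ≡ true
  at-upward {x} {y} x<n y<n e =
    cong proj₂ (sym r) , cong proj₁ (sym r) , is-nothing (trans (bottom-is-just x<n y<n) (bottom-upward _ e)) ,
    trans (left-is-just x<n (ℕ.<⇒≤ y<n)) (left-upward _ e)
    where
    r = cell x y x<n e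
    left-upward : ∀ t → elbowOf t ≡ just upward → left t ≡ true
    left-upward (elbow upward) _ = refl
    bottom-upward : ∀ t → elbowOf t ≡ just upward → bottom t ≡ false
    bottom-upward (elbow upward) _ = refl

-- Invariance of the Demazure product

Apart : ℕ → ℕ → (ℕ × ℕ) × Elbow → Set
Apart x y ((x′ , y′) , _) = x ≢ x′ ⊎ y ≢ y′

-- Absence is conditional on coordinates that differ from those of each listed cell, which
-- inequalities supply directly, rather than on a refutation of list membership.
record Exactly (E : ℕ → ℕ → Maybe Elbow) (i a j b : ℕ) (es : List ((ℕ × ℕ) × Elbow)) : Set where
  field
    present : All (λ { ((x , y) , e) → E x y ≡ just e }) es
    absent  : ∀ {x y} → i ≤ x → x ≤ a → j ≤ y → y ≤ b → All (Apart x y) es → E x y ≡ nothing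

open Exactly

Outside : (i a j b x y : ℕ) → Set
Outside i a j b x y = (x < i ⊎ a < x) ⊎ (y < j ⊎ b < y)

module Compare (P Q : BPD n) {i a j b : ℕ} (i<a : i < a) (a<n : a < n) (j<b : j < b) (b<n : b < n)
  (same : ∀ x y → Outside i a j b x y → elbows P x y ≡ elbows Q x y) where

  private
    module P = Labels P
    module Q = Labels Q

    j≤b = ℕ.<⇒≤ j<b

  SameOn : (lo hi : ℕ) (p q : ℕ → Lab) → Set
  SameOn lo hi p q = ∀ y → lo ≤ y → y < hi → p y ≡ q y

  -- The state of the comparison above row x: the labels on its upper
  -- edges agree outside the columns [ j , b ] and are related by R there.

  record Inv (R : (p q : ℕ → Lab) → Set) (x : ℕ) : Set where
    field
      before-j : SameOn 0 j (P.topL x) (Q.topL x)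
      beyond-b : SameOn (suc b) n (P.topL x) (Q.topL x)
      block    : R (P.topL x) (Q.topL x)
      rights   : ∀ x′ → x ≤ x′ → x′ < n → P.leftL x′ n ≡ Q.leftL x′ n

  Same : (p q : ℕ → Lab) → Set
  Same p q = ∀ y → j ≤ y → y ≤ b → p y ≡ q y

  private

    run : ∀ {x} lo hi → x < n → lo ≤ hi → (∀ y → lo ≤ y → y < hi → elbows P x y ≡ elbows Q x y) →
          SameOn lo hi (P.topL (suc x)) (Q.topL (suc x)) → P.leftL x lo ≡ Q.leftL x lo →
          P.leftL x hi ≡ Q.leftL x hi × SameOn lo hi (P.topL x) (Q.topL x)
    run {x} lo hi x<n lo≤hi eq f s =
      lefts hi lo≤hi ℕ.≤-refl , λ y l h → cong proj₂ (both y l h (lefts y l (ℕ.<⇒≤ h)))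
      where
      both : ∀ y → lo ≤ y → y < hi → P.leftL x y ≡ Q.leftL x y →
             (P.leftL x (suc y) , P.topL x y) ≡ (Q.leftL x (suc y) , Q.topL x y)
      both y l h e = trans (sym (P.cell x y x<n (eq y l h)))
        (trans (cong₂ (step (elbows Q x y)) e (f y l h)) (Q.rule x y x<n))
      lefts : ∀ y → lo ≤ y → y ≤ hi → P.leftL x y ≡ Q.leftL x y
      lefts y l h = ascend (λ y → P.leftL x y ≡ Q.leftL x y) l
        (λ y′ l′ y′<y e → cong proj₁ (both y′ l′ (ℕ.<-≤-trans y′<y h) e)) s

  -- Only the columns from `j` to `b` depend on the move. Separate relations below and above the row
  -- let a row containing elbows turn `Same` into `Drooped` and back.
  row-step : ∀ {R₁ R₀ : (p q : ℕ → Lab) → Set} {x} → x < n →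
    (P.leftL x j ≡ Q.leftL x j → R₁ (P.topL (suc x)) (Q.topL (suc x)) →
     P.leftL x (suc b) ≡ Q.leftL x (suc b) × R₀ (P.topL x) (Q.topL x)) →
    Inv R₁ (suc x) → Inv R₀ x
  row-step {R₁} {R₀} {x} x<n f I = record
    { before-j = proj₂ first ; beyond-b = proj₂ last ; block = proj₂ middle
    ; rights = rights′ }
    where
    open Inv I
    first  = run 0 j x<n z≤n (λ y _ y<j → same x y (inj₂ (inj₁ y<j))) before-j
      (trans (P.start x x<n) (sym (Q.start x x<n)))
    middle = f (proj₁ first) block
    last   = run (suc b) n x<n b<n (λ y b<y _ → same x y (inj₂ (inj₂ b<y))) beyond-b (proj₁ middle)
    rights′ : ∀ x′ → x ≤ x′ → x′ < n → P.leftL x′ n ≡ Q.leftL x′ n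
    rights′ x′ x≤x′ x′<n with x ℕ.≟ x′
    ... | yes refl = proj₁ last
    ... | no x≢x′  = rights x′ (ℕ.≤∧≢⇒< x≤x′ x≢x′) x′<n

  same-block : ∀ {x} → x < n → (∀ y → j ≤ y → y ≤ b → elbows P x y ≡ elbows Q x y) → P.leftL x j ≡ Q.leftL x j →
    Same (P.topL (suc x)) (Q.topL (suc x)) → P.leftL x (suc b) ≡ Q.leftL x (suc b) × Same (P.topL x) (Q.topL x)
  same-block x<n eq e s = proj₁ r , λ y l h → proj₂ r y l (s≤s h)
    where
    r = run j (suc b) x<n (ℕ.m≤n⇒m≤1+n j≤b) (λ y l h → eq y l (ℕ.≤-pred h)) (λ y l h → s y l (ℕ.≤-pred h)) e

  same-step : ∀ {x} → x < n → (∀ y → j ≤ y → y ≤ b → elbows P x y ≡ elbows Q x y) → Inv Same (suc x) → Inv Same x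
  same-step x<n eq = row-step x<n (same-block x<n eq)

  below : Inv Same (suc a)
  below = descend (Inv Same) a<n
    (λ x a<x x<n → same-step x<n (λ y _ _ → same x y (inj₁ (inj₂ a<x))))
    (record
      { before-j = λ y _ _ → bases y ; beyond-b = λ y _ _ → bases y ; block = λ y _ _ → bases y
      ; rights = λ x′ n≤x′ x′<n → ⊥-elim (ℕ.<⇒≱ x′<n n≤x′) })
    where
    bases : ∀ y → P.topL n y ≡ Q.topL n y
    bases y = trans (P.base y) (sym (Q.base y))

  private
    i<n : i < n
    i<n = ℕ.<-trans i<a a<n
    j<n = ℕ.<-trans j<b b<n

    from-top : Inv Same i → ∀ x → x < n → P.leftL x n ≡ Q.leftL x n
    from-top I x x<n = Inv.rights (descend (Inv Same) z≤n
      (λ x _ x<i → same-step (ℕ.<-trans x<i i<n) (λ y _ _ → same x y (inj₁ (inj₁ x<i)))) I) x z≤n x<n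

  -- The part common to all moves: row `a′` has established `Drooped`, the rows strictly between `i`
  -- and `a′` have no elbows in the rectangle, and row `i` ends the difference. A droop has `a′ = a`
  -- and `c = b`, the first K-theoretic type `a′ = a` and `c < b`, the second `a′ < a` and `c = b`.
  module Upper {c a′} (j<c : j < c) (c≤b : c ≤ b) (i<a′ : i < a′) (a′≤a : a′ ≤ a)
    (P-ij : elbows P i j ≡ just downward) (Q-ic : elbows Q i c ≡ just downward)
    (P-i : ∀ y → j < y → y ≤ b → elbows P i y ≡ nothing)
    (Q-i : ∀ y → y ≢ c → j ≤ y → y ≤ b → elbows Q i y ≡ nothing)
    (P-mid : ∀ x y → i < x → x < a′ → j ≤ y → y ≤ b → elbows P x y ≡ nothing)
    (Q-mid : ∀ x y → i < x → x < a′ → j ≤ y → y ≤ b → elbows Q x y ≡ nothing) where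

    conclude : Inv (Drooped j c b) a′ → ∀ x → x < n → P.leftL x n ≡ Q.leftL x n
    conclude I = from-top (row-step i<n
      (λ e D →
        let p₁ , p₂ , p₃ = P.at-downward i<n j<n P-ij
            q₁ , q₂ , q₃ = Q.at-downward i<n (ℕ.≤-<-trans c≤b b<n) Q-ic
        in drooped-end j<c c≤b p₁ p₂ (P.pass i<n (λ y l h → P-i y l (ℕ.≤-pred h)))
             q₁ q₂ (Q.pass i<n (λ y l y<c → Q-i y (ℕ.<⇒≢ y<c) l (ℕ.≤-trans (ℕ.<⇒≤ y<c) c≤b)))
             (Q.pass i<n (λ y c<y h → Q-i y (ℕ.>⇒≢ c<y) (ℕ.<⇒≤ (ℕ.<-trans j<c c<y)) (ℕ.≤-pred h)))
             (trans (sym e) p₃) D)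
      (descend (Inv (Drooped j c b)) i<a′
        (λ x i<x x<a′ →
          let x<n = ℕ.<-trans (ℕ.<-≤-trans x<a′ a′≤a) a<n
          in row-step x<n λ e D → drooped-row j<c c≤b
               (P.pass x<n (λ y l h → P-mid x y i<x x<a′ l (ℕ.≤-pred h)))
               (Q.pass x<n (λ y l h → Q-mid x y i<x x<a′ l (ℕ.≤-pred h))) e D)
        I))

  private
    i≢a = ℕ.<⇒≢ i<a
    j≢b = ℕ.<⇒≢ j<b
    i≤a = ℕ.<⇒≤ i<a

  droop-invariant : Exactly (elbows P) i a j b (((i , j) , downward) ∷ []) →
    Exactly (elbows Q) i a j b (((a , j) , downward) ∷ ((i , b) , downward) ∷ ((a , b) , upward) ∷ []) →
    ∀ x → x < n → P.leftL x n ≡ Q.leftL x n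
  droop-invariant EP EQ with present EP | present EQ
  ... | P-ij ∷ [] | Q-aj ∷ Q-ib ∷ Q-ab ∷ [] =
    Upper.conclude j<b ℕ.≤-refl i<a ℕ.≤-refl P-ij Q-ib
      (λ y j<y y≤b → absent EP ℕ.≤-refl i≤a (ℕ.<⇒≤ j<y) y≤b (inj₂ (ℕ.>⇒≢ j<y) ∷ []))
      (λ y y≢b j≤y y≤b → absent EQ ℕ.≤-refl i≤a j≤y y≤b (inj₁ i≢a ∷ inj₂ y≢b ∷ inj₁ i≢a ∷ []))
      (λ x y i<x x<a j≤y y≤b → absent EP (ℕ.<⇒≤ i<x) (ℕ.<⇒≤ x<a) j≤y y≤b (inj₁ (ℕ.>⇒≢ i<x) ∷ []))
      (λ x y i<x x<a j≤y y≤b → absent EQ (ℕ.<⇒≤ i<x) (ℕ.<⇒≤ x<a) j≤y y≤b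
        (inj₁ (ℕ.<⇒≢ x<a) ∷ inj₁ (ℕ.>⇒≢ i<x) ∷ inj₁ (ℕ.<⇒≢ x<a) ∷ []))
      (row-step a<n (λ e s →
        let q₁ , q₂ , q₃ = Q.at-downward a<n j<n Q-aj
            u₁ , u₂ , u₃ , _ = Q.at-upward a<n b<n Q-ab
        in droop-row j<b s (trans e q₃)
             (P.pass a<n (λ y l h → absent EP i≤a ℕ.≤-refl l (ℕ.≤-pred h) (inj₁ (ℕ.>⇒≢ i<a) ∷ [])))
             q₁ q₂
             (Q.pass a<n (λ y l h → absent EQ i≤a ℕ.≤-refl (ℕ.<⇒≤ l) (ℕ.<⇒≤ h)
               (inj₂ (ℕ.>⇒≢ l) ∷ inj₁ (ℕ.>⇒≢ i<a) ∷ inj₂ (ℕ.<⇒≢ h) ∷ [])))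
             u₃ u₁ u₂)
        below)

  Kdroop₁-invariant : ∀ {c} → j < c → c < b →
    Exactly (elbows P) i a j b (((i , j) , downward) ∷ ((a , c) , downward) ∷ ((a , b) , upward) ∷ []) →
    Exactly (elbows Q) i a j b (((a , j) , downward) ∷ ((i , c) , downward) ∷ ((a , b) , upward) ∷ []) →
    ∀ x → x < n → P.leftL x n ≡ Q.leftL x n
  Kdroop₁-invariant {c} j<c c<b EP EQ with present EP | present EQ
  ... | P-ij ∷ P-ac ∷ P-ab ∷ [] | Q-aj ∷ Q-ic ∷ Q-ab ∷ [] =
    Upper.conclude j<c (ℕ.<⇒≤ c<b) i<a ℕ.≤-refl P-ij Q-ic
      (λ y j<y y≤b → absent EP ℕ.≤-refl i≤a (ℕ.<⇒≤ j<y) y≤b (inj₂ (ℕ.>⇒≢ j<y) ∷ inj₁ i≢a ∷ inj₁ i≢a ∷ []))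
      (λ y y≢c j≤y y≤b → absent EQ ℕ.≤-refl i≤a j≤y y≤b (inj₁ i≢a ∷ inj₂ y≢c ∷ inj₁ i≢a ∷ []))
      (λ x y i<x x<a j≤y y≤b → absent EP (ℕ.<⇒≤ i<x) (ℕ.<⇒≤ x<a) j≤y y≤b
        (inj₁ (ℕ.>⇒≢ i<x) ∷ inj₁ (ℕ.<⇒≢ x<a) ∷ inj₁ (ℕ.<⇒≢ x<a) ∷ []))
      (λ x y i<x x<a j≤y y≤b → absent EQ (ℕ.<⇒≤ i<x) (ℕ.<⇒≤ x<a) j≤y y≤b
        (inj₁ (ℕ.<⇒≢ x<a) ∷ inj₁ (ℕ.>⇒≢ i<x) ∷ inj₁ (ℕ.<⇒≢ x<a) ∷ []))
      (row-step a<n (λ e s →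
        let q₁ , q₂ , q₃ = Q.at-downward a<n j<n Q-aj
            u₁ , u₂ , _ , u₄ = Q.at-upward a<n b<n Q-ab
            p₁ , p₂ , _ = P.at-downward a<n (ℕ.<-trans c<b b<n) P-ac
            v₁ , v₂ , _ , v₄ = P.at-upward a<n b<n P-ab
        in Kdroop₁-row j<c c<b s (trans e q₃)
             (P.pass a<n (λ y l h → P-a y (ℕ.<⇒≢ h) (ℕ.<⇒≢ (ℕ.<-trans h c<b)) l (ℕ.<⇒≤ (ℕ.<-trans h c<b))))
             p₁ p₂
             (P.pass a<n (λ y l h → P-a y (ℕ.>⇒≢ l) (ℕ.<⇒≢ h) (ℕ.<⇒≤ (ℕ.<-trans j<c l)) (ℕ.<⇒≤ h)))
             v₁ v₂ v₄ q₁ q₂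
             (Q.pass a<n (λ y l h → absent EQ i≤a ℕ.≤-refl (ℕ.<⇒≤ l) (ℕ.<⇒≤ h)
               (inj₂ (ℕ.>⇒≢ l) ∷ inj₁ (ℕ.>⇒≢ i<a) ∷ inj₂ (ℕ.<⇒≢ h) ∷ [])))
             u₁ u₂ u₄)
        below)
    where
    P-a : ∀ y → y ≢ c → y ≢ b → j ≤ y → y ≤ b → elbows P a y ≡ nothing
    P-a y y≢c y≢b l h = absent EP i≤a ℕ.≤-refl l h (inj₁ (ℕ.>⇒≢ i<a) ∷ inj₂ y≢c ∷ inj₂ y≢b ∷ [])

  -- The pipe dreams agree from row `a` up to just below row `c`, but the extra crossing at
  -- `(c , b)` is harmless only because of the crossing at `(a , j)`. `SameSorted` carries this
  -- information up the intermediate rows.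
  Kdroop₂-invariant : ∀ {c} → i < c → c < a →
    Exactly (elbows P) i a j b (((i , j) , downward) ∷ ((c , b) , downward) ∷ ((a , b) , upward) ∷ []) →
    Exactly (elbows Q) i a j b (((c , j) , downward) ∷ ((i , b) , downward) ∷ ((a , b) , upward) ∷ []) →
    ∀ x → x < n → P.leftL x n ≡ Q.leftL x n
  Kdroop₂-invariant {c} i<c c<a EP EQ with present EP | present EQ
  ... | P-ij ∷ P-cb ∷ P-ab ∷ [] | Q-cj ∷ Q-ib ∷ Q-ab ∷ [] =
    Upper.conclude j<b ℕ.≤-refl i<c (ℕ.<⇒≤ c<a) P-ij Q-ib
      (λ y j<y y≤b → absent EP ℕ.≤-refl i≤a (ℕ.<⇒≤ j<y) y≤b (inj₂ (ℕ.>⇒≢ j<y) ∷ inj₁ (ℕ.<⇒≢ i<c) ∷ inj₁ i≢a ∷ []))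
      (λ y y≢b j≤y y≤b → absent EQ ℕ.≤-refl i≤a j≤y y≤b (inj₁ (ℕ.<⇒≢ i<c) ∷ inj₂ y≢b ∷ inj₁ i≢a ∷ []))
      (λ x y i<x x<c j≤y y≤b → absent EP (ℕ.<⇒≤ i<x) (ℕ.<⇒≤ (ℕ.<-trans x<c c<a)) j≤y y≤b
        (inj₁ (ℕ.>⇒≢ i<x) ∷ inj₁ (ℕ.<⇒≢ x<c) ∷ inj₁ (ℕ.<⇒≢ (ℕ.<-trans x<c c<a)) ∷ []))
      (λ x y i<x x<c j≤y y≤b → absent EQ (ℕ.<⇒≤ i<x) (ℕ.<⇒≤ (ℕ.<-trans x<c c<a)) j≤y y≤b
        (inj₁ (ℕ.<⇒≢ x<c) ∷ inj₁ (ℕ.>⇒≢ i<x) ∷ inj₁ (ℕ.<⇒≢ (ℕ.<-trans x<c c<a)) ∷ []))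
      (row-step c<n (λ e s →
        let q₁ , q₂ , q₃ = Q.at-downward c<n j<n Q-cj
            p₁ , p₂ , _ = P.at-downward c<n b<n P-cb
        in Kdroop₂-row j<b (proj₁ s) (trans e q₃)
             (P.pass c<n (λ y l h → absent EP (ℕ.<⇒≤ i<c) (ℕ.<⇒≤ c<a) l (ℕ.<⇒≤ h)
               (inj₁ (ℕ.>⇒≢ i<c) ∷ inj₂ (ℕ.<⇒≢ h) ∷ inj₁ (ℕ.<⇒≢ c<a) ∷ [])))
             p₁ p₂ q₁ q₂
             (Q.pass c<n (λ y l h → absent EQ (ℕ.<⇒≤ i<c) (ℕ.<⇒≤ c<a) (ℕ.<⇒≤ l) (ℕ.≤-pred h)
               (inj₂ (ℕ.>⇒≢ l) ∷ inj₁ (ℕ.>⇒≢ i<c) ∷ inj₁ (ℕ.<⇒≢ c<a) ∷ [])))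
             (proj₂ s))
      (descend (Inv SameSorted) c<a
        (λ x c<x x<a →
          let x<n = ℕ.<-trans x<a a<n
              P-x = λ y l h → P-mid x y c<x x<a l h
              Q-x = λ y l h → Q-mid x y c<x x<a l h
          in row-step x<n λ e s →
               let e′ , s′ = same-block x<n (λ y l h → trans (P-x y l h) (sym (Q-x y l h))) e (proj₁ s)
               in e′ , s′ , sorted-row j<b (P.pass x<n (λ y l h → P-x y l (ℕ.≤-pred h))) (proj₂ s))
        (row-step a<n (λ e s →
          let e′ , s′ = same-block a<n same-a e s
              u₁ , _ , _ , u₄ = P.at-upward a<n b<n P-ab
          in e′ , s′ , sorted-base j<b (P.pass a<n (λ y l h → P-a y (ℕ.<⇒≢ h) l (ℕ.<⇒≤ h))) u₁ u₄ column-j)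
          below)))
    where
    c<n = ℕ.<-trans c<a a<n
    SameSorted : (p q : ℕ → Lab) → Set
    SameSorted p q = Same p q × Sorted j b p
    P-mid : ∀ x y → c < x → x < a → j ≤ y → y ≤ b → elbows P x y ≡ nothing
    P-mid x y c<x x<a l h = absent EP (ℕ.<⇒≤ (ℕ.<-trans i<c c<x)) (ℕ.<⇒≤ x<a) l h
      (inj₁ (ℕ.>⇒≢ (ℕ.<-trans i<c c<x)) ∷ inj₁ (ℕ.>⇒≢ c<x) ∷ inj₁ (ℕ.<⇒≢ x<a) ∷ [])
    Q-mid : ∀ x y → c < x → x < a → j ≤ y → y ≤ b → elbows Q x y ≡ nothing
    Q-mid x y c<x x<a l h = absent EQ (ℕ.<⇒≤ (ℕ.<-trans i<c c<x)) (ℕ.<⇒≤ x<a) l h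
      (inj₁ (ℕ.>⇒≢ c<x) ∷ inj₁ (ℕ.>⇒≢ (ℕ.<-trans i<c c<x)) ∷ inj₁ (ℕ.<⇒≢ x<a) ∷ [])
    P-a : ∀ y → y ≢ b → j ≤ y → y ≤ b → elbows P a y ≡ nothing
    P-a y y≢b l h = absent EP i≤a ℕ.≤-refl l h (inj₁ (ℕ.>⇒≢ i<a) ∷ inj₁ (ℕ.>⇒≢ c<a) ∷ inj₂ y≢b ∷ [])
    same-a : ∀ y → j ≤ y → y ≤ b → elbows P a y ≡ elbows Q a y
    same-a y l h with y ℕ.≟ b
    ... | yes refl = trans P-ab (sym Q-ab)
    ... | no y≢b   = trans (P-a y y≢b l h)
      (sym (absent EQ i≤a ℕ.≤-refl l h (inj₁ (ℕ.>⇒≢ c<a) ∷ inj₁ (ℕ.>⇒≢ i<a) ∷ inj₂ y≢b ∷ [])))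
    -- The downward elbow at `(i , j)` receives its pipe from below, and column `j` is straight down
    -- to row `a`; without this label there would be no crossing at `(a , j)` to sort anything.
    column-j : is-just (P.topL (suc a) j) ≡ true
    column-j = ascend (λ x → is-just (P.topL x j) ≡ true) (s≤s i≤a)
      (λ x i<x x<sa e → trans (sym (proj₂ (is-just-cross (P.leftL x j) (P.topL (suc x) j))))
        (trans (cong (is-just ∘ proj₂) (P.cell x j (ℕ.<-≤-trans x<sa a<n)
          (absent EP (ℕ.<⇒≤ i<x) (ℕ.≤-pred x<sa) ℕ.≤-refl j≤b (inj₁ (ℕ.>⇒≢ i<x) ∷ inj₂ j≢b ∷ inj₂ j≢b ∷ [])))) e))
      (trans (P.bottom-is-just i<n j<n) (bottom-downward _ P-ij))
      where
      bottom-downward : ∀ t → elbowOf t ≡ just downward → bottom t ≡ true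
      bottom-downward (elbow downward) _ = refl

-- From moves on the grid to natural coordinates

elbowOf⁻ : ∀ t {e} → elbowOf t ≡ just e → t ≡ elbow e
elbowOf⁻ (elbow _) refl = refl

sameElbow⇒ : ∀ {s t} → SameElbow s t → elbowOf s ≡ elbowOf t
sameElbow⇒ {s} {t} f with elbowOf s in p | elbowOf t in q
... | just e  | _       = sym (trans (sym q) (cong elbowOf (to (f e) (elbowOf⁻ s p))))
... | nothing | just e  = trans (sym p) (cong elbowOf (from (f e) (elbowOf⁻ t q)))
... | nothing | nothing = refl

sameElbow⇐ : ∀ {s t} → elbowOf s ≡ elbowOf t → SameElbow s t
sameElbow⇐ {s} {t} q e = mk⇔ (λ { refl → elbowOf⁻ t (sym q) }) (λ { refl → elbowOf⁻ s q })

place : (Fin n × Fin n) × Elbow → (ℕ × ℕ) × Elbow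
place ((x , y) , e) = (toℕ x , toℕ y) , e

ExactlyIn : BPD n → Rectangle n → ElbowList n → Set
ExactlyIn P R es = Exactly (elbows P) (toℕ (i R)) (toℕ (a R)) (toℕ (j R)) (toℕ (b R)) (List.map place es)

exactly⇒ : (P : BPD n) (R : Rectangle n) (es : ElbowList n) → All (λ { ((x , y) , _) → Inside R x y }) es →
           ElbowsAreExactly P R es → ExactlyIn P R es
exactly⇒ {n} P R es inside f .present = map⁺ (All.tabulate λ { {(x , y) , e} p →
  trans (cong elbowOf (extend-toℕ P x y)) (cong elbowOf (from (f x y e (All.lookup inside p)) p)) })
exactly⇒ {n} P R es inside f .absent {x} {y} i≤x x≤a j≤y y≤b = 
  go (fromℕ< x<n) (fromℕ< y<n) (toℕ-fromℕ< x<n) (toℕ-fromℕ< y<n) i≤x x≤a j≤y y≤b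
  where
  x<n = ℕ.≤-<-trans x≤a (toℕ<n (a R))
  y<n = ℕ.≤-<-trans y≤b (toℕ<n (b R))
  go : ∀ x′ y′ {x y} → toℕ {n} x′ ≡ x → toℕ {n} y′ ≡ y → toℕ (i R) ≤ x → x ≤ toℕ (a R) → toℕ (j R) ≤ y → y ≤ toℕ (b R) →
       All (Apart x y) (List.map place es) → elbows P x y ≡ nothing
  go x′ y′ refl refl p q r s apart with elbowOf (extend P (toℕ x′) (toℕ y′)) in eq
  ... | nothing = refl
  ... | just e  with All.lookup (map⁻ apart) (to (f x′ y′ e ((p , q) , (r , s)))
                       (elbowOf⁻ _ (trans (cong elbowOf (sym (extend-toℕ P x′ y′))) eq)))
  ...   | inj₁ x≢ = ⊥-elim (x≢ refl)
  ...   | inj₂ y≢ = ⊥-elim (y≢ refl)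

exactly⇐ : (P : BPD n) (R : Rectangle n) (es : ElbowList n) → ExactlyIn P R es → ElbowsAreExactly P R es
exactly⇐ {n} P R es E x y e ((p , q) , (r , s)) = mk⇔ member at
  where
  at : ∀ {e} → ((x , y) , e) ∈ₗ es → tile P x y ≡ elbow e
  at m = elbowOf⁻ _ (trans (cong elbowOf (sym (extend-toℕ P x y))) (All.lookup (map⁻ (present E)) m))
  search : ∀ es′ → (∃[ e ] ((x , y) , e) ∈ₗ es′) ⊎ All (Apart (toℕ x) (toℕ y)) (List.map place es′)
  search [] = inj₂ []
  search (((x′ , y′) , e) ∷ es′) with x Fin.≟ x′ | y Fin.≟ y′ | search es′
  ... | yes refl | yes refl | _               = inj₁ (e , here refl)
  ... | _        | _        | inj₁ (e′ , m) = inj₁ (e′ , there m)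
  ... | no x≢    | _        | inj₂ apart      = inj₂ (inj₁ (x≢ ∘ toℕ-injective) ∷ apart)
  ... | yes _    | no y≢    | inj₂ apart      = inj₂ (inj₂ (y≢ ∘ toℕ-injective) ∷ apart)
  elbow-injective : ∀ {e e′} → elbow e ≡ elbow e′ → e ≡ e′
  elbow-injective refl = refl
  member : tile P x y ≡ elbow e → ((x , y) , e) ∈ₗ es
  member t with search es
  ... | inj₁ (e′ , m) = subst (λ e → ((x , y) , e) ∈ₗ es) (elbow-injective (trans (sym (at m)) t)) m
  ... | inj₂ apart with trans (sym (cong elbowOf t)) (trans (sym (cong elbowOf (extend-toℕ P x y))) (absent E p q r s apart))
  ...   | ()

before-inside : (m : Move n) → All (λ { ((x , y) , _) → Inside (rectangle m) x y }) (before m)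
before-inside (droop R) = ((ℕ.≤-refl , ℕ.<⇒≤ (Rectangle.i<a R)) , (ℕ.≤-refl , ℕ.<⇒≤ (Rectangle.j<b R))) ∷ []
before-inside (Kdroop₁ R _ j<j′ j′<b) =
  ((ℕ.≤-refl , ℕ.<⇒≤ (Rectangle.i<a R)) , (ℕ.≤-refl , ℕ.<⇒≤ (Rectangle.j<b R))) ∷
  ((ℕ.<⇒≤ (Rectangle.i<a R) , ℕ.≤-refl) , (ℕ.<⇒≤ j<j′ , ℕ.<⇒≤ j′<b)) ∷
  ((ℕ.<⇒≤ (Rectangle.i<a R) , ℕ.≤-refl) , (ℕ.<⇒≤ (Rectangle.j<b R) , ℕ.≤-refl)) ∷ []
before-inside (Kdroop₂ R _ i<i′ i′<a) =
  ((ℕ.≤-refl , ℕ.<⇒≤ (Rectangle.i<a R)) , (ℕ.≤-refl , ℕ.<⇒≤ (Rectangle.j<b R))) ∷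
  ((ℕ.<⇒≤ i<i′ , ℕ.<⇒≤ i′<a) , (ℕ.<⇒≤ (Rectangle.j<b R) , ℕ.≤-refl)) ∷
  ((ℕ.<⇒≤ (Rectangle.i<a R) , ℕ.≤-refl) , (ℕ.<⇒≤ (Rectangle.j<b R) , ℕ.≤-refl)) ∷ []

after-inside : (m : Move n) → All (λ { ((x , y) , _) → Inside (rectangle m) x y }) (after m)
after-inside (droop R) =
  ((ℕ.<⇒≤ (Rectangle.i<a R) , ℕ.≤-refl) , (ℕ.≤-refl , ℕ.<⇒≤ (Rectangle.j<b R))) ∷
  ((ℕ.≤-refl , ℕ.<⇒≤ (Rectangle.i<a R)) , (ℕ.<⇒≤ (Rectangle.j<b R) , ℕ.≤-refl)) ∷
  ((ℕ.<⇒≤ (Rectangle.i<a R) , ℕ.≤-refl) , (ℕ.<⇒≤ (Rectangle.j<b R) , ℕ.≤-refl)) ∷ []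
after-inside (Kdroop₁ R _ j<j′ j′<b) =
  ((ℕ.<⇒≤ (Rectangle.i<a R) , ℕ.≤-refl) , (ℕ.≤-refl , ℕ.<⇒≤ (Rectangle.j<b R))) ∷
  ((ℕ.≤-refl , ℕ.<⇒≤ (Rectangle.i<a R)) , (ℕ.<⇒≤ j<j′ , ℕ.<⇒≤ j′<b)) ∷
  ((ℕ.<⇒≤ (Rectangle.i<a R) , ℕ.≤-refl) , (ℕ.<⇒≤ (Rectangle.j<b R) , ℕ.≤-refl)) ∷ []
after-inside (Kdroop₂ R _ i<i′ i′<a) =
  ((ℕ.<⇒≤ i<i′ , ℕ.<⇒≤ i′<a) , (ℕ.≤-refl , ℕ.<⇒≤ (Rectangle.j<b R))) ∷
  ((ℕ.≤-refl , ℕ.<⇒≤ (Rectangle.i<a R)) , (ℕ.<⇒≤ (Rectangle.j<b R) , ℕ.≤-refl)) ∷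
  ((ℕ.<⇒≤ (Rectangle.i<a R) , ℕ.≤-refl) , (ℕ.<⇒≤ (Rectangle.j<b R) , ℕ.≤-refl)) ∷ []

allowed⇒ : (m : Move n) (P : BPD n) → Allowed m P → ElbowsAreExactly P (rectangle m) (before m)
allowed⇒ (droop _)          P = proj₁
allowed⇒ (Kdroop₁ _ _ _ _) P f = f
allowed⇒ (Kdroop₂ _ _ _ _) P f = f

outside⇒ : (R : Rectangle n) → ∀ x y → Outside (toℕ (i R)) (toℕ (a R)) (toℕ (j R)) (toℕ (b R)) (toℕ x) (toℕ y) → ¬ Inside R x y
outside⇒ R x y (inj₁ (inj₁ x<i)) ((i≤x , _) , _) = ℕ.<⇒≱ x<i i≤x
outside⇒ R x y (inj₁ (inj₂ a<x)) ((_ , x≤a) , _) = ℕ.<⇒≱ a<x x≤a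
outside⇒ R x y (inj₂ (inj₁ y<j)) (_ , (j≤y , _)) = ℕ.<⇒≱ y<j j≤y
outside⇒ R x y (inj₂ (inj₂ b<y)) (_ , (_ , y≤b)) = ℕ.<⇒≱ b<y y≤b

∂-invariant : (m : Move n) (P Q : BPD n) → Allowed m P → Result m P Q → ∀ i → ∂ P i ≡ ∂ Q i
∂-invariant {n} m P Q al (res , same) r = map-injective toℕ-injective
  (trans (Labels.∂-left P r) (trans (invariant m (exactly⇒ P (rectangle m) _ (before-inside m) (allowed⇒ m P al))
    (exactly⇒ Q (rectangle m) _ (after-inside m) res) same (toℕ r) (toℕ<n r)) (sym (Labels.∂-left Q r))))
  where
  SameOutside : Rectangle n → Set
  SameOutside R = ∀ x y → ¬ Inside R x y → SameElbow (tile P x y) (tile Q x y)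
  elbows-outside : ∀ R → SameOutside R → ∀ x y → Outside (toℕ (i R)) (toℕ (a R)) (toℕ (j R)) (toℕ (b R)) x y →
                   elbows P x y ≡ elbows Q x y
  elbows-outside R same x y out =
    extend-cong P Q x y λ { x′ y′ refl refl → sameElbow⇒ (same x′ y′ (outside⇒ R x′ y′ out)) }
  module Cmp (R : Rectangle n) (same : SameOutside R) =
    Compare P Q (Rectangle.i<a R) (toℕ<n (a R)) (Rectangle.j<b R) (toℕ<n (b R)) (elbows-outside R same)
  invariant : (m : Move n) → ExactlyIn P (rectangle m) (before m) → ExactlyIn Q (rectangle m) (after m) →
    SameOutside (rectangle m) → ∀ x → x < n → Labels.leftL P x n ≡ Labels.leftL Q x n
  invariant (droop R)              p q s = Cmp.droop-invariant R s p q
  invariant (Kdroop₁ R _ j<c c<b) p q s = Cmp.Kdroop₁-invariant R s j<c c<b p q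
  invariant (Kdroop₂ R _ i<c c<a) p q s = Cmp.Kdroop₂-invariant R s i<c c<a p q

-- Toggling the edges along the boundary of a rectangle

turn : (l r : Bool) → Maybe Elbow
turn false true  = just downward
turn true  false = just upward
turn false false = nothing
turn true  true  = nothing

elbowOf-turn : ∀ t → elbowOf t ≡ turn (left t) (right t)
elbowOf-turn (elbow downward) = refl
elbowOf-turn (elbow upward)   = refl
elbowOf-turn crossing         = refl
elbowOf-turn blank            = refl
elbowOf-turn horizontal       = refl
elbowOf-turn vertical         = refl

bit : Bool → ℕ
bit false = 0
bit true  = 1

-- As many pipes enter a tile through the left and bottom edges as leave
-- it through the right and top edges.

Balanced : (l r t b : Bool) → Set
Balanced l r t b = bit l + bit b ≡ bit r + bit t

balanced : ∀ t → Balanced (left t) (right t) (top t) (bottom t)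
balanced (elbow downward) = refl
balanced (elbow upward)   = refl
balanced crossing         = refl
balanced blank            = refl
balanced horizontal       = refl
balanced vertical         = refl

-- The bottom edge is fixed by `Balanced`, and so is the top edge at an elbow.
tileWith : (l r t : Bool) → Tile
tileWith false true  _     = elbow downward
tileWith true  false _     = elbow upward
tileWith true  true  true  = crossing
tileWith true  true  false = horizontal
tileWith false false true  = vertical
tileWith false false false = blank

left-tileWith : ∀ l r t → left (tileWith l r t) ≡ l
left-tileWith false true  _     = refl
left-tileWith true  false _     = refl
left-tileWith true  true  true  = refl
left-tileWith true  true  false = refl
left-tileWith false false true  = refl
left-tileWith false false false = refl

right-tileWith : ∀ l r t → right (tileWith l r t) ≡ r
right-tileWith false true  _     = refl
right-tileWith true  false _     = refl
right-tileWith true  true  true  = refl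
right-tileWith true  true  false = refl
right-tileWith false false true  = refl
right-tileWith false false false = refl

top-tileWith : ∀ l r t b → Balanced l r t b → top (tileWith l r t) ≡ t
top-tileWith false true  false _     _  = refl
top-tileWith false true  true  false ()
top-tileWith false true  true  true  ()
top-tileWith true  false true  _     _  = refl
top-tileWith true  false false false ()
top-tileWith true  false false true  ()
top-tileWith true  true  true  _     _  = refl
top-tileWith true  true  false _     _  = refl
top-tileWith false false true  _     _  = refl
top-tileWith false false false _     _  = refl

bottom-tileWith : ∀ l r t b → Balanced l r t b → bottom (tileWith l r t) ≡ b
bottom-tileWith false true  _     true  _  = refl
bottom-tileWith false true  true  false ()
bottom-tileWith false true  false false ()
bottom-tileWith true  false _     false _  = refl
bottom-tileWith true  false true  true  ()
bottom-tileWith true  false false true  ()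
bottom-tileWith true  true  true  true  _  = refl
bottom-tileWith true  true  true  false ()
bottom-tileWith true  true  false false _  = refl
bottom-tileWith true  true  false true  ()
bottom-tileWith false false true  true  _  = refl
bottom-tileWith false false true  false ()
bottom-tileWith false false false false _  = refl
bottom-tileWith false false false true  ()

private

  toggle-lr : ∀ {l r t b} β → l ≡ β → r ≡ β → Balanced l r t b → Balanced (not l) (not r) t b
  toggle-lr β refl refl e = cong (bit (not β) +_) (ℕ.+-cancelˡ-≡ (bit β) _ _ e)

  toggle-tb : ∀ {l r t b} β → t ≡ β → b ≡ β → Balanced l r t b → Balanced l r (not t) (not b)
  toggle-tb β refl refl e = cong (_+ bit (not β)) (ℕ.+-cancelʳ-≡ (bit β) _ _ e)

  toggle-rb : ∀ {l r t b} β → r ≡ β → b ≡ β → Balanced l r t b → Balanced l (not r) t (not b)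
  toggle-rb {l} {t = t} β refl refl e = trans (ℕ.+-comm (bit l) (bit (not β)))
    (cong (bit (not β) +_) (ℕ.+-cancelˡ-≡ (bit β) _ _ (trans (ℕ.+-comm (bit β) (bit l)) e)))

  toggle-lt : ∀ {l r t b} β → l ≡ β → t ≡ β → Balanced l r t b → Balanced (not l) r (not t) b
  toggle-lt {r = r} β refl refl e = trans
    (cong (bit (not β) +_) (ℕ.+-cancelˡ-≡ (bit β) _ _ (trans e (ℕ.+-comm (bit r) (bit β)))))
    (ℕ.+-comm (bit (not β)) (bit r))

  toggle-lb : ∀ {l r t b} β → l ≡ β → b ≡ not β → Balanced l r t b → Balanced (not l) r t (not b)
  toggle-lb true  refl refl e = e
  toggle-lb false refl refl e = e

  toggle-rt : ∀ {l r t b} β → r ≡ not β → t ≡ β → Balanced l r t b → Balanced l (not r) (not t) b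
  toggle-rt true  refl refl e = e
  toggle-rt false refl refl e = e

-- A and A′ tell whether the two upper and the two lower corners of the
-- cell lie in the rows of a rectangle of lattice points, B and B′ the same
-- for columns; an edge is toggled if exactly one of its ends is in it.

balanced-toggle : ∀ A A′ B B′ {l r t b} β → Balanced l r t b →
  (A ≡ false → A′ ≡ true  → (B ≡ true → l ≡ β) × (B′ ≡ true → r ≡ β)) →
  (A ≡ true  → A′ ≡ false → (B ≡ true → l ≡ not β) × (B′ ≡ true → r ≡ not β)) →
  (B ≡ false → B′ ≡ true  → (A ≡ true → t ≡ β) × (A′ ≡ true → b ≡ β)) →
  (B ≡ true  → B′ ≡ false → (A ≡ true → t ≡ not β) × (A′ ≡ true → b ≡ not β)) →
  Balanced (((A xor A′) ∧ B) xor l) (((A xor A′) ∧ B′) xor r) (((B xor B′) ∧ A) xor t) (((B xor B′) ∧ A′) xor b)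
balanced-toggle false false false false β e p q p′ q′ = e
balanced-toggle false false false true  β e p q p′ q′ = e
balanced-toggle false false true  false β e p q p′ q′ = e
balanced-toggle false false true  true  β e p q p′ q′ = e
balanced-toggle true  true  false false β e p q p′ q′ = e
balanced-toggle true  true  true  true  β e p q p′ q′ = e
balanced-toggle false true  false false β e p q p′ q′ = e
balanced-toggle true  false false false β e p q p′ q′ = e
balanced-toggle true  true  false true  β e p q p′ q′ = toggle-tb β (proj₁ (p′ refl refl) refl) (proj₂ (p′ refl refl) refl) e
balanced-toggle true  true  true  false β e p q p′ q′ = toggle-tb (not β) (proj₁ (q′ refl refl) refl) (proj₂ (q′ refl refl) refl) e
balanced-toggle false true  true  true  β e p q p′ q′ = toggle-lr β (proj₁ (p refl refl) refl) (proj₂ (p refl refl) refl) e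
balanced-toggle true  false true  true  β e p q p′ q′ = toggle-lr (not β) (proj₁ (q refl refl) refl) (proj₂ (q refl refl) refl) e
balanced-toggle false true  false true  β e p q p′ q′ = toggle-rb β (proj₂ (p refl refl) refl) (proj₂ (p′ refl refl) refl) e
balanced-toggle false true  true  false {l} {r} {t} {b} β e p q p′ q′ =
  toggle-lb {l} {r} {t} {b} β (proj₁ (p refl refl) refl) (proj₂ (q′ refl refl) refl) e
balanced-toggle true  false false true  {l} {r} {t} {b} β e p q p′ q′ =
  toggle-rt {l} {r} {t} {b} β (proj₂ (q refl refl) refl) (proj₁ (p′ refl refl) refl) e
balanced-toggle true  false true  false β e p q p′ q′ = toggle-lt (not β) (proj₁ (q refl refl) refl) (proj₁ (q′ refl refl) refl) e

within : (l u x : ℕ) → Bool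
within l u x = does (l ℕ.<? x) ∧ does (x ℕ.≤? u)

within-inside : ∀ {l u x} → l < x → x ≤ u → within l u x ≡ true
within-inside {l} {u} {x} p q = cong₂ _∧_ (dec-true (l ℕ.<? x) p) (dec-true (x ℕ.≤? u) q)

within-before : ∀ {l u x} → x ≤ l → within l u x ≡ false
within-before {l} {u} {x} p = cong (_∧ does (x ℕ.≤? u)) (dec-false (l ℕ.<? x) (ℕ.≤⇒≯ p))

within-beyond : ∀ {l u x} → u < x → within l u x ≡ false
within-beyond {l} {u} {x} p = trans (cong (does (l ℕ.<? x) ∧_) (dec-false (x ℕ.≤? u) (ℕ.<⇒≱ p))) (∧-zeroʳ _)

within⁻ : ∀ {l u x} → within l u x ≡ true → l < x × x ≤ u
within⁻ {l} {u} {x} e with l ℕ.<? x | x ℕ.≤? u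
... | yes p | yes q = p , q
... | yes p | no ¬q with trans (sym e) (within-beyond {l} (ℕ.≰⇒> ¬q))
...   | ()
within⁻ {l} {u} {x} e | no ¬p | _ with trans (sym e) (within-before {l} {u} (ℕ.≮⇒≥ ¬p))
...   | ()

within-enter : ∀ {l u x} → within l u x ≡ false → within l u (suc x) ≡ true → x ≡ l
within-enter {l} {u} {x} e f with within⁻ f | l ℕ.<? x
... | _ , q | yes p with trans (sym e) (within-inside p (ℕ.<⇒≤ q))
...   | ()
within-enter {l} {u} {x} e f | p , _ | no ¬p = ℕ.≤-antisym (ℕ.≮⇒≥ ¬p) (ℕ.≤-pred p)

within-leave : ∀ {l u x} → within l u x ≡ true → within l u (suc x) ≡ false → x ≡ u
within-leave {l} {u} {x} e f with within⁻ e | x ℕ.<? u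
... | p , _ | yes q with trans (sym f) (within-inside (ℕ.m≤n⇒m≤1+n p) q)
...   | ()
within-leave {l} {u} {x} e f | _ , q | no ¬q = ℕ.≤-antisym q (ℕ.≮⇒≥ ¬q)

within-steady : ∀ {l u x} → x ≢ l → x ≢ u → within l u x ≡ within l u (suc x)
within-steady {l} {u} {x} x≢l x≢u with within l u x in e | within l u (suc x) in f
... | true  | true  = refl
... | false | false = refl
... | true  | false = ⊥-elim (x≢u (within-leave e f))
... | false | true  = ⊥-elim (x≢l (within-enter e f))

-- The toggled edges are those met by the closed path through the centres of the outer cells of the
-- rectangle, which surrounds its inner lattice points. With `β = true` the pipes lie on the upper
-- and left sides, and flipping performs a move; with `β = false` it undoes one.
module Flip (P : BPD n) {i a j c : ℕ} (i<a : i < a) (a<n : a < n) (j<c : j < c) (c<n : c < n) (β : Bool)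
  (h-i : ∀ y → j < y → y ≤ c → left (extend P i y) ≡ β)
  (h-a : ∀ y → j < y → y ≤ c → left (extend P a y) ≡ not β)
  (v-j : ∀ x → i < x → x ≤ a → top (extend P x j) ≡ β)
  (v-c : ∀ x → i < x → x ≤ a → top (extend P x c) ≡ not β) where

  open Edges P

  private

    h v h′ v′ : ℕ → ℕ → Bool
    h x y = left (extend P x y)
    v x y = top (extend P x y)

    A B : ℕ → Bool
    A = within i a
    B = within j c

    h′ x y = ((A x xor A (suc x)) ∧ B y) xor h x y
    v′ x y = ((B y xor B (suc y)) ∧ A x) xor v x y

    rows-i : ∀ {x} y → A x ≡ false → A (suc x) ≡ true → B y ≡ true → h x y ≡ β
    rows-i y e f g with within-enter {i} {a} e f | within⁻ {j} {c} g
    ... | refl | p , q = h-i y p q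

    rows-a : ∀ {x} y → A x ≡ true → A (suc x) ≡ false → B y ≡ true → h x y ≡ not β
    rows-a y e f g with within-leave {i} {a} e f | within⁻ {j} {c} g
    ... | refl | p , q = h-a y p q

    columns-j : ∀ x {y} → B y ≡ false → B (suc y) ≡ true → A x ≡ true → v x y ≡ β
    columns-j x e f g with within-enter {j} {c} e f | within⁻ {i} {a} g
    ... | refl | p , q = v-j x p q

    columns-c : ∀ x {y} → B y ≡ true → B (suc y) ≡ false → A x ≡ true → v x y ≡ not β
    columns-c x e f g with within-leave {j} {c} e f | within⁻ {i} {a} g
    ... | refl | p , q = v-c x p q

    balanced′ : ∀ x y → Balanced (h′ x y) (h′ x (suc y)) (v′ x y) (v′ (suc x) y)
    balanced′ x y = balanced-toggle (A x) (A (suc x)) (B y) (B (suc y)) β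
      (subst₂ (λ r b → Balanced (h x y) r (v x y) b) (right-left x y) (bottom-top x y) (balanced (extend P x y)))
      (λ e f → rows-i y e f , rows-i (suc y) e f) (λ e f → rows-a y e f , rows-a (suc y) e f)
      (λ e f → columns-j x e f , columns-j (suc x) e f) (λ e f → columns-c x e f , columns-c (suc x) e f)

    tile′ : ℕ → ℕ → Tile
    tile′ x y = tileWith (h′ x y) (h′ x (suc y)) (v′ x y)

    left′ : ∀ x y → left (tile′ x y) ≡ h′ x y
    left′ x y = left-tileWith (h′ x y) (h′ x (suc y)) (v′ x y)
    right′ : ∀ x y → right (tile′ x y) ≡ h′ x (suc y)
    right′ x y = right-tileWith (h′ x y) (h′ x (suc y)) (v′ x y)
    top′ : ∀ x y → top (tile′ x y) ≡ v′ x y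
    top′ x y = top-tileWith (h′ x y) (h′ x (suc y)) (v′ x y) (v′ (suc x) y) (balanced′ x y)
    bottom′ : ∀ x y → bottom (tile′ x y) ≡ v′ (suc x) y
    bottom′ x y = bottom-tileWith (h′ x y) (h′ x (suc y)) (v′ x y) (v′ (suc x) y) (balanced′ x y)

    h′-unchanged : ∀ x {y} → B y ≡ false → h′ x y ≡ h x y
    h′-unchanged x {y} e = cong (_xor h x y) (trans (cong ((A x xor A (suc x)) ∧_) e) (∧-zeroʳ _))
    v′-unchanged : ∀ {x} y → A x ≡ false → v′ x y ≡ v x y
    v′-unchanged {x} y e = cong (_xor v x y) (trans (cong ((B y xor B (suc y)) ∧_) e) (∧-zeroʳ _))

  flip : BPD n
  flip .tile x y = tile′ (toℕ x) (toℕ y)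
  flip .left-right x {y} {y′} q = trans (right′ (toℕ x) (toℕ y))
    (trans (cong (h′ (toℕ x)) (sym q)) (sym (left′ (toℕ x) (toℕ y′))))
  flip .top-bottom {x} {x′} y q = trans (bottom′ (toℕ x) (toℕ y))
    (trans (cong (λ u → v′ u (toℕ y)) (sym q)) (sym (top′ (toℕ x′) (toℕ y))))
  flip .left-boundary x y q = trans (left′ (toℕ x) (toℕ y)) (trans (cong (h′ (toℕ x)) q)
    (trans (h′-unchanged (toℕ x) (within-before {j} {c} z≤n)) (left-first (toℕ x))))
  flip .right-boundary x y q = trans (right′ (toℕ x) (toℕ y)) (trans (cong (h′ (toℕ x)) q)
    (trans (h′-unchanged (toℕ x) (within-beyond {j} {c} c<n)) (left-last (toℕ<n x))))
  flip .top-boundary x y q = trans (top′ (toℕ x) (toℕ y)) (trans (cong (λ u → v′ u (toℕ y)) q)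
    (trans (v′-unchanged (toℕ y) (within-before {i} {a} z≤n)) (top-first (toℕ y))))
  flip .bottom-boundary x y q = trans (bottom′ (toℕ x) (toℕ y)) (trans (cong (λ u → v′ u (toℕ y)) q)
    (trans (v′-unchanged (toℕ y) (within-beyond {i} {a} a<n)) (top-last (toℕ<n y))))

  private

    extend-flip : ∀ {x y} → x < n → y < n → extend flip x y ≡ tile′ x y
    extend-flip p q = trans (extend-inside flip p q) (cong₂ tile′ (toℕ-fromℕ< p) (toℕ-fromℕ< q))

    elbows-flip : ∀ {x y} → x < n → y < n → elbows flip x y ≡ turn (h′ x y) (h′ x (suc y))
    elbows-flip {x} {y} p q = trans (cong elbowOf (extend-flip p q))
      (trans (elbowOf-turn (tile′ x y)) (cong₂ turn (left′ x y) (right′ x y)))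

    h′-toggled : ∀ x {y} → A x xor A (suc x) ≡ true → B y ≡ true → h′ x y ≡ not (h x y)
    h′-toggled x {y} e f = cong (_xor h x y) (cong₂ _∧_ e f)

    changes-i : A i xor A (suc i) ≡ true
    changes-i = cong₂ _xor_ (within-before {i} {a} ℕ.≤-refl) (within-inside {i} {a} ℕ.≤-refl i<a)

    changes-a : A a xor A (suc a) ≡ true
    changes-a = cong₂ _xor_ (within-inside {i} {a} i<a ℕ.≤-refl) (within-beyond {i} {a} ℕ.≤-refl)

    B-j : B j ≡ false
    B-j = within-before {j} {c} ℕ.≤-refl
    B-sj : B (suc j) ≡ true
    B-sj = within-inside {j} {c} ℕ.≤-refl j<c
    B-c : B c ≡ true
    B-c = within-inside {j} {c} j<c ℕ.≤-refl
    B-sc : B (suc c) ≡ false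
    B-sc = within-beyond {j} {c} ℕ.≤-refl

    i<n = ℕ.<-trans i<a a<n
    j<n = ℕ.<-trans j<c c<n

    not-not : ∀ β → not (not β) ≡ β
    not-not true  = refl
    not-not false = refl

    h′-ac : h′ a c ≡ β
    h′-ac = trans (h′-toggled a changes-a B-c) (trans (cong not (h-a c j<c ℕ.≤-refl)) (not-not β))

  flip-ij : elbows flip i j ≡ turn (h i j) (not β)
  flip-ij = trans (elbows-flip i<n j<n) (cong₂ turn (h′-unchanged i B-j)
    (trans (h′-toggled i {_} changes-i B-sj) (cong not (h-i (suc j) ℕ.≤-refl j<c))))

  flip-aj : elbows flip a j ≡ turn (h a j) β
  flip-aj = trans (elbows-flip a<n j<n) (cong₂ turn (h′-unchanged a B-j)
    (trans (h′-toggled a changes-a B-sj) (trans (cong not (h-a (suc j) ℕ.≤-refl j<c)) (not-not β))))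

  flip-ic : elbows flip i c ≡ turn (not β) (h i (suc c))
  flip-ic = trans (elbows-flip i<n c<n) (cong₂ turn
    (trans (h′-toggled i {_} changes-i B-c) (cong not (h-i c j<c ℕ.≤-refl))) (h′-unchanged i B-sc))

  flip-ac : elbows flip a c ≡ turn β (h a (suc c))
  flip-ac = trans (elbows-flip a<n c<n) (cong₂ turn h′-ac (h′-unchanged a B-sc))

  tile-flip-ac : extend flip a c ≡ tileWith β (h a (suc c)) β
  tile-flip-ac = trans (extend-flip a<n c<n) (cong₂ (λ f t → f t) (cong₂ tileWith h′-ac (h′-unchanged a B-sc)) v′-ac)
    where
    v′-ac : v′ a c ≡ β
    v′-ac = trans (cong (_xor v a c) (cong₂ _∧_ (cong₂ _xor_ B-c B-sc) (within-inside {i} {a} i<a ℕ.≤-refl)))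
      (trans (cong not (v-c a i<a ℕ.≤-refl)) (not-not β))

  -- The elbow of a tile can be read off its left and right edges. Outside rows `i` and `a` neither
  -- is toggled. Outside columns `j` and `c` they are toggled together or not at all, and when
  -- toggled they are equal, so no elbow appears or vanishes.
  flip-elsewhere : ∀ {x y} → x < n → y < n → (x ≢ i × x ≢ a) ⊎ (y ≢ j × y ≢ c) → elbows flip x y ≡ elbows P x y
  flip-elsewhere {x} {y} p q off = trans (elbows-flip p q) (trans (unchanged off)
    (sym (trans (elbowOf-turn (extend P x y)) (cong (turn (h x y)) (right-left x y)))))
    where
    turn-not : ∀ {l r} γ → l ≡ γ → r ≡ γ → turn (not l) (not r) ≡ turn l r
    turn-not false refl refl = refl
    turn-not true  refl refl = refl
    toggled : ∀ k k′ b → A x ≡ k → A (suc x) ≡ k′ → B y ≡ b → B (suc y) ≡ b →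
      turn (((k xor k′) ∧ b) xor h x y) (((k xor k′) ∧ b) xor h x (suc y)) ≡ turn (h x y) (h x (suc y))
    toggled false false b     e f g g′ = refl
    toggled true  true  b     e f g g′ = refl
    toggled false true  false e f g g′ = refl
    toggled true  false false e f g g′ = refl
    toggled false true  true  e f g g′ = turn-not β (rows-i y e f g) (rows-i (suc y) e f g′)
    toggled true  false true  e f g g′ = turn-not (not β) (rows-a y e f g) (rows-a (suc y) e f g′)
    unchanged : (x ≢ i × x ≢ a) ⊎ (y ≢ j × y ≢ c) → turn (h′ x y) (h′ x (suc y)) ≡ turn (h x y) (h x (suc y))
    unchanged (inj₁ (x≢i , x≢a)) = cong₂ turn (same y) (same (suc y))
      where
      same : ∀ y → h′ x y ≡ h x y
      same y = cong (λ k → (k ∧ B y) xor h x y)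
        (trans (cong (A x xor_) (sym (within-steady {i} {a} x≢i x≢a))) (xor-same (A x)))
    unchanged (inj₂ (y≢j , y≢c)) = trans
      (cong (λ b → turn (h′ x y) (((A x xor A (suc x)) ∧ b) xor h x (suc y))) (sym B-steady))
      (toggled (A x) (A (suc x)) (B y) refl refl refl (sym B-steady))
      where
      B-steady = within-steady {j} {c} y≢j y≢c

corner? : ∀ i a j c x y →
  ((x ≡ i ⊎ x ≡ a) × (y ≡ j ⊎ y ≡ c)) ⊎ ((x ≢ i × x ≢ a) ⊎ (y ≢ j × y ≢ c))
corner? i a j c x y with x ℕ.≟ i | x ℕ.≟ a | y ℕ.≟ j | y ℕ.≟ c
... | no p  | no q  | _     | _     = inj₂ (inj₁ (p , q))
... | _     | _     | no p  | no q  = inj₂ (inj₂ (p , q))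
... | yes p | _     | yes q | _     = inj₁ (inj₁ p , inj₁ q)
... | yes p | _     | no _  | yes q = inj₁ (inj₁ p , inj₂ q)
... | no _  | yes p | yes q | _     = inj₁ (inj₂ p , inj₁ q)
... | no _  | yes p | no _  | yes q = inj₁ (inj₂ p , inj₂ q)

-- Existence of the results of moves

module Straight (P : BPD n) where

  open Edges P

  left-straight : ∀ {x y} → elbows P x y ≡ nothing → left (extend P x y) ≡ left (extend P x (suc y))
  left-straight {x} {y} e = trans (go (extend P x y) e) (right-left x y)
    where
    go : ∀ t → elbowOf t ≡ nothing → left t ≡ right t
    go crossing   _ = refl
    go blank      _ = refl
    go horizontal _ = refl
    go vertical   _ = refl

  top-straight : ∀ {x y} → elbows P x y ≡ nothing → top (extend P x y) ≡ top (extend P (suc x) y)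
  top-straight {x} {y} e = trans (go (extend P x y) e) (bottom-top x y)
    where
    go : ∀ t → elbowOf t ≡ nothing → top t ≡ bottom t
    go crossing   _ = refl
    go blank      _ = refl
    go horizontal _ = refl
    go vertical   _ = refl

  downward-edges : ∀ {x y} → elbows P x y ≡ just downward →
    (left (extend P x y) ≡ false × left (extend P x (suc y)) ≡ true) ×
    (top (extend P x y) ≡ false × top (extend P (suc x) y) ≡ true)
  downward-edges {x} {y} e with elbowOf⁻ (extend P x y) e
  ... | t = (cong left t , trans (sym (right-left x y)) (cong right t)) ,
            (cong top t , trans (sym (bottom-top x y)) (cong bottom t))

  upward-edges : ∀ {x y} → elbows P x y ≡ just upward →
    (left (extend P x y) ≡ true × left (extend P x (suc y)) ≡ false) ×
    (top (extend P x y) ≡ true × top (extend P (suc x) y) ≡ false)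
  upward-edges {x} {y} e with elbowOf⁻ (extend P x y) e
  ... | t = (cong left t , trans (sym (right-left x y)) (cong right t)) ,
            (cong top t , trans (sym (bottom-top x y)) (cong bottom t))

-- Each move acts on a rectangle [ i , a ] × [ j , c ] whose only elbows are
-- a downward one at (i , j) and possibly one at (a , c).

module Forward (P : BPD n) {i a j c : ℕ} (i<a : i < a) (a<n : a < n) (j<c : j < c) (c<n : c < n)
  (ij : elbows P i j ≡ just downward)
  (rest : ∀ {x y} → i ≤ x → x ≤ a → j ≤ y → y ≤ c → x ≢ i ⊎ y ≢ j → x ≢ a ⊎ y ≢ c → elbows P x y ≡ nothing)
  (h-ac : left (extend P a c) ≡ false) (v-ac : top (extend P a c) ≡ false) where

  open Straight P

  private
    i≤a = ℕ.<⇒≤ i<a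
    j≤c = ℕ.<⇒≤ j<c

    h-i : ∀ y → j < y → y ≤ c → left (extend P i y) ≡ true
    h-i y j<y y≤c = ascend (λ y → left (extend P i y) ≡ true) j<y
      (λ y′ j<y′ y′<y → trans (sym (left-straight
        (rest ℕ.≤-refl i≤a (ℕ.<⇒≤ j<y′) (ℕ.<⇒≤ (ℕ.<-≤-trans y′<y y≤c)) (inj₂ (ℕ.>⇒≢ j<y′)) (inj₁ (ℕ.<⇒≢ i<a))))))
      (proj₂ (proj₁ (downward-edges ij)))

    h-a : ∀ y → j ≤ y → y ≤ c → left (extend P a y) ≡ false
    h-a y j≤y y≤c = descend (λ y → left (extend P a y) ≡ false) y≤c
      (λ y′ y≤y′ y′<c → trans (left-straight
        (rest i≤a ℕ.≤-refl (ℕ.≤-trans j≤y y≤y′) (ℕ.<⇒≤ y′<c) (inj₁ (ℕ.>⇒≢ i<a)) (inj₂ (ℕ.<⇒≢ y′<c)))))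
      h-ac

    v-j : ∀ x → i < x → x ≤ a → top (extend P x j) ≡ true
    v-j x i<x x≤a = ascend (λ x → top (extend P x j) ≡ true) i<x
      (λ x′ i<x′ x′<x → trans (sym (top-straight
        (rest (ℕ.<⇒≤ i<x′) (ℕ.<⇒≤ (ℕ.<-≤-trans x′<x x≤a)) ℕ.≤-refl j≤c (inj₁ (ℕ.>⇒≢ i<x′)) (inj₂ (ℕ.<⇒≢ j<c))))))
      (proj₂ (proj₂ (downward-edges ij)))

    v-c : ∀ x → i < x → x ≤ a → top (extend P x c) ≡ false
    v-c x i<x x≤a = descend (λ x → top (extend P x c) ≡ false) x≤a
      (λ x′ x≤x′ x′<a → trans (top-straight
        (rest (ℕ.≤-trans (ℕ.<⇒≤ i<x) x≤x′) (ℕ.<⇒≤ x′<a) j≤c ℕ.≤-refl (inj₂ (ℕ.>⇒≢ j<c)) (inj₁ (ℕ.<⇒≢ x′<a)))))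
      v-ac

  open Flip P i<a a<n j<c c<n true h-i (λ y j<y → h-a y (ℕ.<⇒≤ j<y)) v-j v-c
    public

  flip-ij-nothing : elbows flip i j ≡ nothing
  flip-ij-nothing = trans flip-ij (cong (λ l → turn l false) (proj₁ (proj₁ (downward-edges ij))))

  flip-aj-downward : elbows flip a j ≡ just downward
  flip-aj-downward = trans flip-aj (cong (λ l → turn l true) (h-a j ℕ.≤-refl j≤c))

  flip-ic-downward : elbows flip i c ≡ just downward
  flip-ic-downward = trans flip-ic (cong (turn false) (trans (sym (left-straight
    (rest ℕ.≤-refl i≤a j≤c ℕ.≤-refl (inj₂ (ℕ.>⇒≢ j<c)) (inj₁ (ℕ.<⇒≢ i<a))))) (h-i c j<c ℕ.≤-refl)))

apart-refl : ∀ {x y e} {A : Set} → Apart x y ((x , y) , e) → A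
apart-refl (inj₁ x≢x) = ⊥-elim (x≢x refl)
apart-refl (inj₂ y≢y) = ⊥-elim (y≢y refl)

module Results (P : BPD n) {i a j b : ℕ} (i<a : i < a) (a<n : a < n) (j<b : j < b) (b<n : b < n) where

  open Straight P

  droop-result : Exactly (elbows P) i a j b (((i , j) , downward) ∷ []) → extend P a b ≡ blank →
    ∃[ Q ] Exactly (elbows {n} Q) i a j b (((a , j) , downward) ∷ ((i , b) , downward) ∷ ((a , b) , upward) ∷ []) ×
           (∀ {x y} → x < n → y < n → (x ≢ i × x ≢ a) ⊎ (y ≢ j × y ≢ b) → elbows Q x y ≡ elbows P x y)
  droop-result E blank-ab with present E
  ... | ij ∷ [] = flip , exactly , flip-elsewhere
    where
    open Forward P i<a a<n j<b b<n ij (λ p q r s t _ → absent E p q r s (t ∷ [])) (cong left blank-ab) (cong top blank-ab)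
    exactly : Exactly (elbows flip) i a j b (((a , j) , downward) ∷ ((i , b) , downward) ∷ ((a , b) , upward) ∷ [])
    exactly .present = flip-aj-downward ∷ flip-ic-downward ∷
      trans flip-ac (cong (turn true) (trans (sym (left-straight {y = b} (cong elbowOf blank-ab))) (cong left blank-ab))) ∷ []
    exactly .absent {x} {y} p q r s (aj ∷ ib ∷ ab ∷ []) with corner? i a j b x y
    ... | inj₁ (inj₁ refl , inj₁ refl) = flip-ij-nothing
    ... | inj₁ (inj₁ refl , inj₂ refl) = apart-refl {e = downward} ib
    ... | inj₁ (inj₂ refl , inj₁ refl) = apart-refl {e = downward} aj
    ... | inj₁ (inj₂ refl , inj₂ refl) = apart-refl {e = upward} ab
    ... | inj₂ off = trans (flip-elsewhere (ℕ.≤-<-trans q a<n) (ℕ.≤-<-trans s b<n) off)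
                       (absent E p q r s (Sum.map proj₁ proj₁ off ∷ []))

  Kdroop₁-result : ∀ {c} → j < c → c < b →
    Exactly (elbows P) i a j b (((i , j) , downward) ∷ ((a , c) , downward) ∷ ((a , b) , upward) ∷ []) →
    ∃[ Q ] Exactly (elbows {n} Q) i a j b (((a , j) , downward) ∷ ((i , c) , downward) ∷ ((a , b) , upward) ∷ []) ×
           (∀ {x y} → x < n → y < n → (x ≢ i × x ≢ a) ⊎ (y ≢ j × y ≢ c) → elbows Q x y ≡ elbows P x y)
  Kdroop₁-result {c} j<c c<b E with present E
  ... | ij ∷ ac ∷ ab ∷ [] = flip , exactly , flip-elsewhere
    where
    edges = downward-edges ac
    open Forward P i<a a<n j<c (ℕ.<-trans c<b b<n) ij
      (λ p q r s t u → absent E p q r (ℕ.≤-trans s (ℕ.<⇒≤ c<b)) (t ∷ u ∷ inj₂ (ℕ.<⇒≢ (ℕ.≤-<-trans s c<b)) ∷ []))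
      (proj₁ (proj₁ edges)) (proj₁ (proj₂ edges))
    exactly : Exactly (elbows flip) i a j b (((a , j) , downward) ∷ ((i , c) , downward) ∷ ((a , b) , upward) ∷ [])
    exactly .present = flip-aj-downward ∷ flip-ic-downward ∷
      trans (flip-elsewhere a<n b<n (inj₂ (ℕ.>⇒≢ j<b , ℕ.>⇒≢ c<b))) ab ∷ []
    exactly .absent {x} {y} p q r s (aj ∷ ic ∷ ab′ ∷ []) with corner? i a j c x y
    ... | inj₁ (inj₁ refl , inj₁ refl) = flip-ij-nothing
    ... | inj₁ (inj₁ refl , inj₂ refl) = apart-refl {e = downward} ic
    ... | inj₁ (inj₂ refl , inj₁ refl) = apart-refl {e = downward} aj
    ... | inj₁ (inj₂ refl , inj₂ refl) = trans flip-ac (cong (turn true) (proj₂ (proj₁ edges)))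
    ... | inj₂ off = trans (flip-elsewhere (ℕ.≤-<-trans q a<n) (ℕ.≤-<-trans s b<n) off)
                       (absent E p q r s (Sum.map proj₁ proj₁ off ∷ Sum.map proj₂ proj₂ off ∷ ab′ ∷ []))

  Kdroop₂-result : ∀ {c} → i < c → c < a →
    Exactly (elbows P) i a j b (((i , j) , downward) ∷ ((c , b) , downward) ∷ ((a , b) , upward) ∷ []) →
    ∃[ Q ] Exactly (elbows {n} Q) i a j b (((c , j) , downward) ∷ ((i , b) , downward) ∷ ((a , b) , upward) ∷ []) ×
           (∀ {x y} → x < n → y < n → (x ≢ i × x ≢ c) ⊎ (y ≢ j × y ≢ b) → elbows Q x y ≡ elbows P x y)
  Kdroop₂-result {c} i<c c<a E with present E
  ... | ij ∷ cb ∷ ab ∷ [] = flip , exactly , flip-elsewhere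
    where
    edges = downward-edges cb
    open Forward P i<c (ℕ.<-trans c<a a<n) j<b b<n ij
      (λ p q r s t u → absent E p (ℕ.≤-trans q (ℕ.<⇒≤ c<a)) r s (t ∷ u ∷ inj₁ (ℕ.<⇒≢ (ℕ.≤-<-trans q c<a)) ∷ []))
      (proj₁ (proj₁ edges)) (proj₁ (proj₂ edges))
    exactly : Exactly (elbows flip) i a j b (((c , j) , downward) ∷ ((i , b) , downward) ∷ ((a , b) , upward) ∷ [])
    exactly .present = flip-aj-downward ∷ flip-ic-downward ∷
      trans (flip-elsewhere a<n b<n (inj₁ (ℕ.>⇒≢ i<a , ℕ.>⇒≢ c<a))) ab ∷ []
    exactly .absent {x} {y} p q r s (cj ∷ ib ∷ ab′ ∷ []) with corner? i c j b x y
    ... | inj₁ (inj₁ refl , inj₁ refl) = flip-ij-nothing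
    ... | inj₁ (inj₁ refl , inj₂ refl) = apart-refl {e = downward} ib
    ... | inj₁ (inj₂ refl , inj₁ refl) = apart-refl {e = downward} cj
    ... | inj₁ (inj₂ refl , inj₂ refl) = trans flip-ac (cong (turn true) (proj₂ (proj₁ edges)))
    ... | inj₂ off = trans (flip-elsewhere (ℕ.≤-<-trans q a<n) (ℕ.≤-<-trans s b<n) off)
                       (absent E p q r s (Sum.map proj₁ proj₁ off ∷ Sum.map proj₂ proj₂ off ∷ ab′ ∷ []))

off-rectangle : (R : Rectangle n) → ∀ {p q} →
  toℕ (i R) < p × p ≤ toℕ (a R) → toℕ (j R) < q × q ≤ toℕ (b R) →
  ∀ x y → ¬ Inside R x y → (toℕ x ≢ toℕ (i R) × toℕ x ≢ p) ⊎ (toℕ y ≢ toℕ (j R) × toℕ y ≢ q)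
off-rectangle R {p} {q} P Q x y ¬in with corner? (toℕ (i R)) p (toℕ (j R)) q (toℕ x) (toℕ y)
... | inj₂ off     = off
... | inj₁ (f , g) = ⊥-elim (¬in (between f P , between g Q))
  where
  between : ∀ {x l p u} → x ≡ l ⊎ x ≡ p → l < p × p ≤ u → l ≤ x × x ≤ u
  between (inj₁ refl) (l<p , p≤u) = ℕ.≤-refl , ℕ.<⇒≤ (ℕ.<-≤-trans l<p p≤u)
  between (inj₂ refl) (l<p , p≤u) = ℕ.<⇒≤ l<p , p≤u

sameElbow-toℕ : (P Q : BPD n) → ∀ x y → elbows Q (toℕ x) (toℕ y) ≡ elbows P (toℕ x) (toℕ y) →
                SameElbow (tile P x y) (tile Q x y)
sameElbow-toℕ P Q x y e = sameElbow⇐ (trans (cong elbowOf (sym (extend-toℕ P x y)))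
  (trans (sym e) (cong elbowOf (extend-toℕ Q x y))))

-- A move is specified by elbows alone, and not every placement of elbows belongs to a pipe dream;
-- closure therefore includes the existence of the new one.
result-exists : (m : Move n) (P : BPD n) → Allowed m P → ∃[ Q ] Result m P Q
result-exists m@(droop R) P (E , blank-ab)
  with Results.droop-result P (Rectangle.i<a R) (toℕ<n (a R)) (Rectangle.j<b R) (toℕ<n (b R))
         (exactly⇒ P R _ (before-inside m) E) (trans (extend-toℕ P (a R) (b R)) blank-ab)
... | Q , E′ , same = Q , exactly⇐ Q R (after m) E′ , λ x y ¬in → sameElbow-toℕ P Q x y (same (toℕ<n x) (toℕ<n y)
  (off-rectangle R (Rectangle.i<a R , ℕ.≤-refl) (Rectangle.j<b R , ℕ.≤-refl) x y ¬in))
result-exists m@(Kdroop₁ R _ j<c c<b) P E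
  with Results.Kdroop₁-result P (Rectangle.i<a R) (toℕ<n (a R)) (Rectangle.j<b R) (toℕ<n (b R)) j<c c<b
         (exactly⇒ P R _ (before-inside m) E)
... | Q , E′ , same = Q , exactly⇐ Q R (after m) E′ , λ x y ¬in → sameElbow-toℕ P Q x y (same (toℕ<n x) (toℕ<n y)
  (off-rectangle R (Rectangle.i<a R , ℕ.≤-refl) (j<c , ℕ.<⇒≤ c<b) x y ¬in))
result-exists m@(Kdroop₂ R _ i<c c<a) P E
  with Results.Kdroop₂-result P (Rectangle.i<a R) (toℕ<n (a R)) (Rectangle.j<b R) (toℕ<n (b R)) i<c c<a
         (exactly⇒ P R _ (before-inside m) E)
... | Q , E′ , same = Q , exactly⇐ Q R (after m) E′ , λ x y ¬in → sameElbow-toℕ P Q x y (same (toℕ<n x) (toℕ<n y)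
  (off-rectangle R (i<c , ℕ.<⇒≤ c<a) (Rectangle.j<b R , ℕ.≤-refl) x y ¬in))

-- Reachability

switch : (f : ℕ → Bool) → ∀ {l u} → l ≤ u → f l ≡ false → f u ≡ true →
         ∃[ m ] l ≤ m × m < u × f m ≡ false × f (suc m) ≡ true
switch f {u = zero}  z≤n p q with trans (sym p) q
... | ()
switch f {l} {suc u} l≤u p q with l ℕ.≟ suc u
switch f {l} {suc u} l≤u p q | yes refl with trans (sym p) q
... | ()
switch f {l} {suc u} l≤u p q | no l≢ with f u in e
... | false = u , ℕ.≤-pred (ℕ.≤∧≢⇒< l≤u l≢) , ℕ.≤-refl , e , q
... | true  with switch f (ℕ.≤-pred (ℕ.≤∧≢⇒< l≤u l≢)) p e
...   | m , l≤m , m<u , r = m , l≤m , ℕ.m≤n⇒m≤1+n m<u , r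

¬both : ∀ {b : Bool} {A : Set} → b ≡ false → b ≡ true → A
¬both refl ()

-- Regions without upward elbows

module Monotone (P : BPD n) where

  open Edges P
  open Straight P

  elbows-turn : ∀ x y → elbows P x y ≡ turn (left (extend P x y)) (left (extend P x (suc y)))
  elbows-turn x y = trans (elbowOf-turn (extend P x y)) (cong (turn (left (extend P x y))) (right-left x y))

  private
    left-step : ∀ {x y} → elbows P x y ≢ just upward → left (extend P x y) ≡ true → left (extend P x (suc y)) ≡ true
    left-step {x} {y} ¬up e with elbows P x y in eq
    ... | just upward   = ⊥-elim (¬up refl)
    ... | just downward = ¬both (proj₁ (proj₁ (downward-edges eq))) e
    ... | nothing       = trans (sym (left-straight eq)) e

    top-step : ∀ {x y} → elbows P x y ≢ just upward → top (extend P x y) ≡ true → top (extend P (suc x) y) ≡ true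
    top-step {x} {y} ¬up e with elbows P x y in eq
    ... | just upward   = ⊥-elim (¬up refl)
    ... | just downward = ¬both (proj₁ (proj₂ (downward-edges eq))) e
    ... | nothing       = trans (sym (top-straight eq)) e

  module Row (x m : ℕ) (¬up : ∀ y → y < m → elbows P x y ≢ just upward) where

    stays : ∀ {y z} → y ≤ z → z ≤ m → left (extend P x y) ≡ true → left (extend P x z) ≡ true
    stays y≤z z≤m = ascend (λ y → left (extend P x y) ≡ true) y≤z
      (λ y′ _ y′<z → left-step (¬up y′ (ℕ.<-≤-trans y′<z z≤m)))

    was-not : ∀ {y z} → y ≤ z → z ≤ m → left (extend P x z) ≡ false → left (extend P x y) ≡ false
    was-not {y} y≤z z≤m e with left (extend P x y) in eq
    ... | false = refl
    ... | true  = ¬both e (stays y≤z z≤m eq)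

  module Column (y m : ℕ) (¬up : ∀ x → x < m → elbows P x y ≢ just upward) where

    stays : ∀ {x z} → x ≤ z → z ≤ m → top (extend P x y) ≡ true → top (extend P z y) ≡ true
    stays x≤z z≤m = ascend (λ x → top (extend P x y) ≡ true) x≤z
      (λ x′ _ x′<z → top-step (¬up x′ (ℕ.<-≤-trans x′<z z≤m)))

    was-not : ∀ {x z} → x ≤ z → z ≤ m → top (extend P z y) ≡ false → top (extend P x y) ≡ false
    was-not {x} x≤z z≤m e with top (extend P x y) in eq
    ... | false = refl
    ... | true  = ¬both e (stays x≤z z≤m eq)

-- Without upward elbows every row has a single downward elbow, and the
-- label of the pipe turning there is the number of its column.

module NoUpward (P : BPD n) (¬up : ∀ x y → x < n → y < n → elbows P x y ≢ just upward) where

  open Edges P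
  open Straight P
  open Monotone P
  open Labels P

  private
    turning : ∀ {x} → x < n → ∃[ d ] d < n × left (extend P x d) ≡ false × left (extend P x (suc d)) ≡ true
    turning {x} x<n with switch (λ y → left (extend P x y)) z≤n (left-first x) (left-last x<n)
    ... | d , _ , d<n , e , f = d , d<n , e , f

  column : ∀ {x} → x < n → ℕ
  column x<n = proj₁ (turning x<n)

  column-downward : ∀ {x} (x<n : x < n) → elbows P x (column x<n) ≡ just downward
  column-downward {x} x<n =
    let d , _ , e , f = turning x<n in trans (elbows-turn x d) (cong₂ turn e f)

  column-unique : ∀ {x y} (x<n : x < n) → y < n → elbows P x y ≡ just downward → y ≡ column x<n
  column-unique {x} {y} x<n y<n e with ℕ.<-cmp y (column x<n)
  ... | tri≈ _ y≡d _ = y≡d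
  ... | tri< y<d _ _ =
    let d , d<n , p , _ = turning x<n
    in ¬both p (Row.stays x n (λ y → ¬up x y x<n) y<d (ℕ.<⇒≤ d<n) (proj₂ (proj₁ (downward-edges e))))
  ... | tri> _ _ d<y =
    let d , _ , _ , q = turning x<n
    in ¬both (proj₁ (proj₁ (downward-edges e))) (Row.stays x n (λ y → ¬up x y x<n) d<y (ℕ.<⇒≤ y<n) q)

  private
    TopOwn : ℕ → Set
    TopOwn x = ∀ y → y < n → topL x y ≡ nothing ⊎ topL x y ≡ just y

    LeftOwn : ∀ {x} → x < n → ℕ → Set
    LeftOwn {x} x<n y = leftL x y ≡ nothing ⊎ (leftL x y ≡ just (column x<n) × column x<n < y)

    -- A pipe travelling in row `x` has turned strictly to the left of column `y`, so at a crossing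
    -- the horizontal label is the smaller one and both labels go straight on.
    cell-own : ∀ {x} (x<n : x < n) → TopOwn (suc x) → ∀ y → y < n → LeftOwn x<n y →
               LeftOwn x<n (suc y) × (topL x y ≡ nothing ⊎ topL x y ≡ just y)
    cell-own {x} x<n own y y<n l with elbows P x y in eq
    ... | just upward = ⊥-elim (¬up x y x<n y<n eq)
    cell-own {x} x<n own y y<n l | just downward with at-downward x<n y<n eq | own y y<n
    ... | p , q , _ | inj₁ t = inj₁ (trans p t) , inj₁ q
    ... | p , q , _ | inj₂ t = inj₂ (trans p (trans t (cong just y≡)) , ℕ.≤-reflexive (cong suc (sym y≡))) , inj₁ q
      where y≡ = column-unique x<n y<n eq
    cell-own {x} x<n own y y<n l | nothing with l | own y y<n | cell x y x<n eq
    ... | inj₁ p | inj₁ q | r with trans (sym r) (cong₂ cross p q)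
    ...   | s = inj₁ (cong proj₁ s) , inj₁ (cong proj₂ s)
    cell-own {x} x<n own y y<n l | nothing | inj₁ p | inj₂ q | r with trans (sym r) (cong₂ cross p q)
    ...   | s = inj₁ (cong proj₁ s) , inj₂ (cong proj₂ s)
    cell-own {x} x<n own y y<n l | nothing | inj₂ (p , d<y) | inj₁ q | r with trans (sym r) (cong₂ cross p q)
    ...   | s = inj₂ (cong proj₁ s , ℕ.m≤n⇒m≤1+n d<y) , inj₁ (cong proj₂ s)
    cell-own {x} x<n own y y<n l | nothing | inj₂ (p , d<y) | inj₂ q | r
      with trans (sym r) (trans (cong₂ cross p q) (cross-sorted (ℕ.<⇒≤ d<y)))
    ...   | s = inj₂ (cong proj₁ s , ℕ.m≤n⇒m≤1+n d<y) , inj₂ (cong proj₂ s)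

    lefts-own : ∀ {x} (x<n : x < n) → TopOwn (suc x) → ∀ y → y ≤ n → LeftOwn x<n y
    lefts-own x<n own zero    _   = inj₁ (start _ x<n)
    lefts-own x<n own (suc y) y<n = proj₁ (cell-own x<n own y y<n (lefts-own x<n own y (ℕ.<⇒≤ y<n)))

    tops-own : ∀ {x} → x ≤ n → TopOwn x
    tops-own x≤n = descend TopOwn x≤n
      (λ x _ x<n own y y<n → proj₂ (cell-own x<n own y y<n (lefts-own x<n own y (ℕ.<⇒≤ y<n))))
      (λ y _ → inj₂ (base y))

  column-label : ∀ {x} (x<n : x < n) → leftL x n ≡ just (column x<n)
  column-label {x} x<n with lefts-own x<n (tops-own x<n) n ℕ.≤-refl
  ... | inj₂ (p , _) = p
  ... | inj₁ p       = ¬both (cong is-just p) (trans (left-is-just x<n ℕ.≤-refl) (left-last x<n))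

  rothe : (w : Permutation′ n) → Pipes w P → Φ w ≈ P
  rothe w pipes = determined (Φ w) P λ x y e → mk⇔
    (λ t → case-from (to (Φ-elbows w x y e) t))
    (λ t → from (Φ-elbows w x y e) (case-to x y e t))
    where
    column-w : ∀ x → toℕ (w ⟨$⟩ʳ x) ≡ column (toℕ<n x)
    column-w x = just-injective (trans (sym (cong (map toℕ) (pipes x))) (trans (∂-left x) (column-label (toℕ<n x))))
    case-from : ∀ {x y e} → e ≡ downward × w ⟨$⟩ʳ x ≡ y → tile P x y ≡ elbow e
    case-from {x} (refl , refl) = elbowOf⁻ _ (trans (cong elbowOf (sym (extend-toℕ P x (w ⟨$⟩ʳ x))))
      (trans (cong (elbows P (toℕ x)) (column-w x)) (column-downward (toℕ<n x))))
    case-to : ∀ x y e → tile P x y ≡ elbow e → e ≡ downward × w ⟨$⟩ʳ x ≡ y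
    case-to x y downward t = refl , toℕ-injective (trans (column-w x)
      (sym (column-unique (toℕ<n x) (toℕ<n y) (cong elbowOf (trans (extend-toℕ P x y) t)))))
    case-to x y upward t = ⊥-elim (¬up (toℕ x) (toℕ y) (toℕ<n x) (toℕ<n y) (cong elbowOf (trans (extend-toℕ P x y) t)))

-- Used with `f` and `g` recording the pipes just right of columns `j` and `b`: a row where they
-- differ contains a downward elbow in between, and the search finds the lowest such row.
last-change : (f g : ℕ → Bool) → ∀ m → (∀ x → x < m → f x ≡ true → g x ≡ true) →
  (∃[ i ] i < m × f i ≡ false × g i ≡ true × (∀ x → i < x → x < m → f x ≡ g x)) ⊎ (∀ x → x < m → f x ≡ g x)
last-change f g zero    _    = inj₂ λ _ ()
last-change f g (suc m) mono with f m Bool.≟ g m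
... | yes e = Sum.map
  (λ (i , i<m , p , q , rest) → i , ℕ.m≤n⇒m≤1+n i<m , p , q , λ x i<x → up (rest x i<x))
  (λ rest x → up (rest x))
  (last-change f g m (λ x x<m → mono x (ℕ.m≤n⇒m≤1+n x<m)))
  where
  up : ∀ {x} → (x < m → f x ≡ g x) → x < suc m → f x ≡ g x
  up {x} h x<sm with x ℕ.≟ m
  ... | yes refl = e
  ... | no x≢m   = h (ℕ.≤∧≢⇒< (ℕ.≤-pred x<sm) x≢m)
... | no f≢g with f m in p | g m in q
...   | true  | true  = ⊥-elim (f≢g refl)
...   | false | false = ⊥-elim (f≢g refl)
...   | true  | false = ¬both q (mono m ℕ.≤-refl p)
...   | false | true  = inj₁ (m , ℕ.≤-refl , p , q , λ x m<x x<sm → ⊥-elim (ℕ.<⇒≱ m<x (ℕ.≤-pred x<sm)))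

-- Undoing the first upward elbow

record Before (a b : ℕ) (P : BPD n) : Set where
  field
    rows-above : ∀ x y → x < a → y < n → elbows P x y ≢ just upward
    row-left   : ∀ y → y < b → elbows P a y ≢ just upward

droop⟶ : (R : Rectangle n) (P Q : BPD n) →
  ExactlyIn P R (before (droop R)) → extend P (toℕ (a R)) (toℕ (b R)) ≡ blank →
  ExactlyIn Q R (after (droop R)) →
  (∀ {x y} → x < n → y < n → (x ≢ toℕ (i R) × x ≢ toℕ (a R)) ⊎
    (y ≢ toℕ (j R) × y ≢ toℕ (b R)) → elbows P x y ≡ elbows Q x y) → P ⟶ Q
droop⟶ R P Q E blank-ab E′ same =
  droop R , (exactly⇐ P R (before (droop R)) E , trans (sym (extend-toℕ P _ _)) blank-ab) , exactly⇐ Q R (after (droop R)) E′ ,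
  λ x y ¬in → sameElbow-toℕ P Q x y (sym (same (toℕ<n x) (toℕ<n y)
    (off-rectangle R (i<a , ℕ.≤-refl) (j<b , ℕ.≤-refl) x y ¬in)))
  where open Rectangle R using (i<a; j<b)

Kdroop₁⟶ : (R : Rectangle n) (c : Fin n) (P Q : BPD n) (j<c : toℕ (j R) < toℕ c) (c<b : toℕ c < toℕ (b R)) →
  ExactlyIn P R (before (Kdroop₁ R c j<c c<b)) → ExactlyIn Q R (after (Kdroop₁ R c j<c c<b)) →
  (∀ {x y} → x < n → y < n → (x ≢ toℕ (i R) × x ≢ toℕ (a R)) ⊎ (y ≢ toℕ (j R) × y ≢ toℕ c) →
    elbows P x y ≡ elbows Q x y) → P ⟶ Q
Kdroop₁⟶ R c P Q j<c c<b E E′ same =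
  m , exactly⇐ P R (before m) E , exactly⇐ Q R (after m) E′ ,
  λ x y ¬in → sameElbow-toℕ P Q x y (sym (same (toℕ<n x) (toℕ<n y)
    (off-rectangle R (i<a , ℕ.≤-refl) (j<c , ℕ.<⇒≤ c<b) x y ¬in)))
  where
  open Rectangle R using (i<a; j<b)
  m = Kdroop₁ R c j<c c<b

-- Rectangles have coordinates in `Fin n`, while flips are computed with natural numbers. Taking a
-- whole implication as `A` replaces each coordinate by some `toℕ x` without transporting the
-- hypotheses one by one.
finite-elim : (A : ℕ → Set) → (∀ (x : Fin n) → A (toℕ x)) → ∀ {x} → x < n → A x
finite-elim A f x<n = subst A (toℕ-fromℕ< x<n) (f (fromℕ< x<n))

Undrooped : (P Q : BPD n) (i a j b : ℕ) → Set
Undrooped {n} P Q i a j b =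
  i < a → j < b →
  Exactly (elbows P) i a j b (((i , j) , downward) ∷ []) → extend P a b ≡ blank →
  Exactly (elbows Q) i a j b (((a , j) , downward) ∷ ((i , b) , downward) ∷ ((a , b) , upward) ∷ []) →
  (∀ {x y} → x < n → y < n → (x ≢ i × x ≢ a) ⊎ (y ≢ j × y ≢ b) → elbows P x y ≡ elbows Q x y) → P ⟶ Q

droop⟶ℕ : (P Q : BPD n) → ∀ {i a j b} → i < n → a < n → j < n → b < n → Undrooped P Q i a j b
droop⟶ℕ P Q {i} {a} {j} {b} i<n a<n j<n b<n =
  finite-elim (λ i → Undrooped P Q i a j b) (λ i →
  finite-elim (λ a → Undrooped P Q (toℕ i) a j b) (λ a →
  finite-elim (λ j → Undrooped P Q (toℕ i) (toℕ a) j b) (λ j →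
  finite-elim (λ b → Undrooped P Q (toℕ i) (toℕ a) (toℕ j) b) (λ b i<a j<b →
  droop⟶ (record { i<a = i<a ; j<b = j<b }) P Q) b<n) j<n) a<n) i<n

UnKdrooped₁ : (P Q : BPD n) (i a j c b : ℕ) → Set
UnKdrooped₁ {n} P Q i a j c b =
  i < a → j < c → c < b →
  Exactly (elbows P) i a j b (((i , j) , downward) ∷ ((a , c) , downward) ∷ ((a , b) , upward) ∷ []) →
  Exactly (elbows Q) i a j b (((a , j) , downward) ∷ ((i , c) , downward) ∷ ((a , b) , upward) ∷ []) →
  (∀ {x y} → x < n → y < n → (x ≢ i × x ≢ a) ⊎ (y ≢ j × y ≢ c) → elbows P x y ≡ elbows Q x y) → P ⟶ Q

Kdroop₁⟶ℕ : (P Q : BPD n) → ∀ {i a j c b} → i < n → a < n → j < n → c < n → b < n → UnKdrooped₁ P Q i a j c b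
Kdroop₁⟶ℕ P Q {i} {a} {j} {c} {b} i<n a<n j<n c<n b<n =
  finite-elim (λ i → UnKdrooped₁ P Q i a j c b) (λ i →
  finite-elim (λ a → UnKdrooped₁ P Q (toℕ i) a j c b) (λ a →
  finite-elim (λ j → UnKdrooped₁ P Q (toℕ i) (toℕ a) j c b) (λ j →
  finite-elim (λ c → UnKdrooped₁ P Q (toℕ i) (toℕ a) (toℕ j) c b) (λ c →
  finite-elim (λ b → UnKdrooped₁ P Q (toℕ i) (toℕ a) (toℕ j) (toℕ c) b) (λ b i<a j<c c<b →
  Kdroop₁⟶ (record { i<a = i<a ; j<b = ℕ.<-trans j<c c<b }) c P Q j<c c<b) b<n) c<n) j<n) a<n) i<n

-- The first upward elbow in reading order can be moved by an inverse
-- droop or an inverse K-theoretic droop of the first type.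

module Undo (P : BPD n) {a b : ℕ} (a<n : a < n) (b<n : b < n) (first : Before a b P)
  (ab : elbows P a b ≡ just upward) where

  open Edges P
  open Straight P
  open Monotone P
  open Before first

  private
    h v : ℕ → ℕ → Bool
    h x y = left (extend P x y)
    v x y = top (extend P x y)

    module RowAbove {x} (x<a : x < a) = Row x n (λ y → rows-above x y x<a)
    module RowLeft = Row a b row-left
    module ColumnAbove {y} (y<n : y < n) = Column y a (λ x x<a → rows-above x y x<a y<n)

    -- Pipes only appear from left to right in such a row, so an elbow would make its two ends
    -- differ.
    row-empty : ∀ {x j} → x < a → h x (suc j) ≡ h x (suc b) → ∀ y → j < y → y ≤ b → elbows P x y ≡ nothing
    row-empty {x} x<a e y j<y y≤b with elbows P x y in eq
    ... | nothing       = refl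
    ... | just upward   = ⊥-elim (rows-above x y x<a (ℕ.≤-<-trans y≤b b<n) eq)
    ... | just downward = ¬both
      (RowAbove.was-not x<a j<y (ℕ.≤-trans y≤b (ℕ.<⇒≤ b<n)) (proj₁ (proj₁ (downward-edges eq))))
      (trans e (RowAbove.stays x<a (s≤s y≤b) b<n (proj₂ (proj₁ (downward-edges eq)))))

  module Found {i j c} (i<a : i < a) (j<c : j < c) (c≤b : c ≤ b)
    (h-aj : h a j ≡ false) (h-asj : h a (suc j) ≡ true) (h-ic : h i c ≡ false) (h-isc : h i (suc c) ≡ true)
    (rest : ∀ x → i < x → x < a → h x (suc j) ≡ h x (suc b)) where

    private
      c<n = ℕ.≤-<-trans c≤b b<n
      j<b = ℕ.<-≤-trans j<c c≤b
      j<n = ℕ.<-trans j<c c<n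
      i<n = ℕ.<-trans i<a a<n

      aj : elbows P a j ≡ just downward
      aj = trans (elbows-turn a j) (cong₂ turn h-aj h-asj)
      ic : elbows P i c ≡ just downward
      ic = trans (elbows-turn i c) (cong₂ turn h-ic h-isc)

      h-i : ∀ y → y ≤ c → h i y ≡ false
      h-i y y≤c = RowAbove.was-not i<a y≤c (ℕ.<⇒≤ c<n) h-ic
      h-a : ∀ y → j < y → y ≤ b → h a y ≡ true
      h-a y j<y y≤b = RowLeft.stays j<y y≤b h-asj
      -- A pipe in column `j` above row `a` would persist down to the top edge of the downward elbow
      -- at `(a , j)`, which has none.
      v-j : ∀ x → x ≤ a → v x j ≡ false
      v-j x x≤a = ColumnAbove.was-not j<n x≤a ℕ.≤-refl (proj₁ (proj₂ (downward-edges aj)))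
      v-c : ∀ x → i < x → x ≤ a → v x c ≡ true
      v-c x i<x x≤a = ColumnAbove.stays c<n i<x x≤a (proj₂ (proj₂ (downward-edges ic)))

    open Flip P i<a a<n j<c c<n false (λ y _ → h-i y) (λ y j<y y≤c → h-a y j<y (ℕ.≤-trans y≤c c≤b))
      (λ x _ → v-j x) v-c public

    private
      nothing-P : ∀ {x y} → i ≤ x → x ≤ a → j ≤ y → y ≤ b →
        x ≢ a ⊎ y ≢ j → x ≢ i ⊎ y ≢ c → x ≢ a ⊎ y ≢ b → elbows P x y ≡ nothing
      nothing-P {x} {y} i≤x x≤a j≤y y≤b ¬aj ¬ic ¬ab with x ℕ.≟ a | x ℕ.≟ i
      nothing-P {x} {y} i≤x x≤a j≤y y≤b (inj₁ x≢a) ¬ic ¬ab | yes x≡a | _ = ⊥-elim (x≢a x≡a)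
      nothing-P {x} {y} i≤x x≤a j≤y y≤b (inj₂ y≢j) ¬ic (inj₁ x≢a) | yes x≡a | _ = ⊥-elim (x≢a x≡a)
      nothing-P {x} {y} i≤x x≤a j≤y y≤b (inj₂ y≢j) ¬ic (inj₂ y≢b) | yes refl | _ =
        trans (elbows-turn x y) (cong₂ turn (h-a y j<y y≤b) (h-a (suc y) (ℕ.m≤n⇒m≤1+n j<y) (ℕ.≤∧≢⇒< y≤b y≢b)))
        where j<y = ℕ.≤∧≢⇒< j≤y (y≢j ∘ sym)
      nothing-P {x} {y} i≤x x≤a j≤y y≤b ¬aj (inj₁ x≢i) ¬ab | no _ | yes x≡i = ⊥-elim (x≢i x≡i)
      nothing-P {x} {y} i≤x x≤a j≤y y≤b ¬aj (inj₂ y≢c) ¬ab | no _ | yes refl with ℕ.<-cmp y c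
      ... | tri≈ _ y≡c _ = ⊥-elim (y≢c y≡c)
      ... | tri< y<c _ _ = trans (elbows-turn x y) (cong₂ turn (h-i y (ℕ.<⇒≤ y<c)) (h-i (suc y) y<c))
      ... | tri> _ _ c<y = trans (elbows-turn x y) (cong₂ turn
        (RowAbove.stays i<a c<y (ℕ.≤-trans y≤b (ℕ.<⇒≤ b<n)) h-isc)
        (RowAbove.stays i<a (ℕ.m≤n⇒m≤1+n c<y) (ℕ.≤-<-trans y≤b b<n) h-isc))
      nothing-P {x} {y} i≤x x≤a j≤y y≤b ¬aj ¬ic ¬ab | no x≢a | no x≢i with y ℕ.≟ j
      ... | no y≢j = row-empty x<a (rest x (ℕ.≤∧≢⇒< i≤x (x≢i ∘ sym)) x<a) y (ℕ.≤∧≢⇒< j≤y (y≢j ∘ sym)) y≤b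
        where x<a = ℕ.≤∧≢⇒< x≤a x≢a
      ... | yes refl with elbows P x y in eq
      ...   | nothing       = refl
      ...   | just upward   = ¬both (v-j x x≤a) (proj₁ (proj₂ (upward-edges eq)))
      ...   | just downward = ¬both (v-j (suc x) (ℕ.≤∧≢⇒< x≤a x≢a)) (proj₂ (proj₂ (downward-edges eq)))

      flip-ij-downward : elbows flip i j ≡ just downward
      flip-ij-downward = trans flip-ij (cong (λ l → turn l true) (h-i j (ℕ.<⇒≤ j<c)))
      flip-aj-nothing : elbows flip a j ≡ nothing
      flip-aj-nothing = trans flip-aj (cong (λ l → turn l false) h-aj)
      flip-ic-nothing : elbows flip i c ≡ nothing
      flip-ic-nothing = trans flip-ic (cong (turn true) h-isc)

      flip-not-upward : ∀ x y → x < n → y < n → (x ≡ a → y ≡ c → elbows flip a c ≢ just upward) →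
        elbows P x y ≢ just upward → elbows flip x y ≢ just upward
      flip-not-upward x y x<n y<n ¬ac ¬up e with corner? i a j c x y
      ... | inj₂ off = ¬up (trans (sym (flip-elsewhere x<n y<n off)) e)
      ... | inj₁ (inj₁ refl , inj₁ refl) with trans (sym flip-ij-downward) e
      ...   | ()
      flip-not-upward x y x<n y<n ¬ac ¬up e | inj₁ (inj₁ refl , inj₂ refl) with trans (sym flip-ic-nothing) e
      ...   | ()
      flip-not-upward x y x<n y<n ¬ac ¬up e | inj₁ (inj₂ refl , inj₁ refl) with trans (sym flip-aj-nothing) e
      ...   | ()
      flip-not-upward x y x<n y<n ¬ac ¬up e | inj₁ (inj₂ refl , inj₂ refl) = ¬ac refl refl e

    undo-droop : c ≡ b → flip ⟶ P × Before a (suc b) flip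
    undo-droop refl = droop⟶ℕ flip P i<n a<n j<n b<n i<a j<c E tile-ab E′ flip-elsewhere , record
      { rows-above = λ x y x<a y<n → flip-not-upward x y (ℕ.<-trans x<a a<n) y<n (λ _ _ → ¬ab) (rows-above x y x<a y<n)
      ; row-left   = row-left′ }
      where
      ab-nothing : elbows flip a b ≡ nothing
      ab-nothing = trans flip-ac (cong (turn false) (proj₂ (proj₁ (upward-edges ab))))
      tile-ab : extend flip a b ≡ blank
      tile-ab = trans tile-flip-ac (cong (λ r → tileWith false r false) (proj₂ (proj₁ (upward-edges ab))))
      ¬ab : elbows flip a b ≢ just upward
      ¬ab e with trans (sym ab-nothing) e
      ... | ()
      row-left′ : ∀ y → y < suc b → elbows flip a y ≢ just upward
      row-left′ y y<sb with y ℕ.≟ b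
      ... | yes refl = ¬ab
      ... | no y≢b   = flip-not-upward a y a<n (ℕ.≤-<-trans (ℕ.≤-pred y<sb) b<n) (λ _ _ → ¬ab)
                         (row-left y (ℕ.≤∧≢⇒< (ℕ.≤-pred y<sb) y≢b))
      E : Exactly (elbows flip) i a j b (((i , j) , downward) ∷ [])
      E .present = flip-ij-downward ∷ []
      E .absent {x} {y} p q r s (ij ∷ []) with corner? i a j b x y
      ... | inj₁ (inj₁ refl , inj₁ refl) = apart-refl {e = downward} ij
      ... | inj₁ (inj₁ refl , inj₂ refl) = flip-ic-nothing
      ... | inj₁ (inj₂ refl , inj₁ refl) = flip-aj-nothing
      ... | inj₁ (inj₂ refl , inj₂ refl) = ab-nothing
      ... | inj₂ off = trans (flip-elsewhere (ℕ.≤-<-trans q a<n) (ℕ.≤-<-trans s b<n) off)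
        (nothing-P p q r s (Sum.map proj₂ proj₁ off) (Sum.map proj₁ proj₂ off) (Sum.map proj₂ proj₂ off))
      E′ : Exactly (elbows P) i a j b (((a , j) , downward) ∷ ((i , b) , downward) ∷ ((a , b) , upward) ∷ [])
      E′ .present = aj ∷ ic ∷ ab ∷ []
      E′ .absent p q r s (x ∷ y ∷ z ∷ []) = nothing-P p q r s x y z

    undo-Kdroop₁ : c < b → flip ⟶ P × Before a b flip × elbows flip a b ≡ just upward × left (extend flip a c) ≡ false
    undo-Kdroop₁ c<b = Kdroop₁⟶ℕ flip P i<n a<n j<n c<n b<n i<a j<c c<b E E′ flip-elsewhere , record
      { rows-above = λ x y x<a y<n → flip-not-upward x y (ℕ.<-trans x<a a<n) y<n (λ _ _ → ¬ac) (rows-above x y x<a y<n)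
      ; row-left   = λ y y<b → flip-not-upward a y a<n (ℕ.<-trans y<b b<n) (λ _ _ → ¬ac) (row-left y y<b) } ,
      flip-ab , proj₁ (proj₁ (Straight.downward-edges flip ac-downward))
      where
      ac-downward : elbows flip a c ≡ just downward
      ac-downward = trans flip-ac (cong (turn false) (h-a (suc c) (ℕ.m≤n⇒m≤1+n j<c) c<b))
      ¬ac : elbows flip a c ≢ just upward
      ¬ac e with trans (sym ac-downward) e
      ... | ()
      flip-ab : elbows flip a b ≡ just upward
      flip-ab = trans (flip-elsewhere a<n b<n (inj₂ (ℕ.>⇒≢ j<b , ℕ.>⇒≢ c<b))) ab
      E : Exactly (elbows flip) i a j b (((i , j) , downward) ∷ ((a , c) , downward) ∷ ((a , b) , upward) ∷ [])
      E .present = flip-ij-downward ∷ ac-downward ∷ flip-ab ∷ []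
      E .absent {x} {y} p q r s (ij ∷ ac ∷ ab′ ∷ []) with corner? i a j c x y
      ... | inj₁ (inj₁ refl , inj₁ refl) = apart-refl {e = downward} ij
      ... | inj₁ (inj₁ refl , inj₂ refl) = flip-ic-nothing
      ... | inj₁ (inj₂ refl , inj₁ refl) = flip-aj-nothing
      ... | inj₁ (inj₂ refl , inj₂ refl) = apart-refl {e = downward} ac
      ... | inj₂ off = trans (flip-elsewhere (ℕ.≤-<-trans q a<n) (ℕ.≤-<-trans s b<n) off)
        (nothing-P p q r s (Sum.map proj₂ proj₁ off) (Sum.map proj₁ proj₂ off) ab′)
      E′ : Exactly (elbows P) i a j b (((a , j) , downward) ∷ ((i , c) , downward) ∷ ((a , b) , upward) ∷ [])
      E′ .present = aj ∷ ic ∷ ab ∷ []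
      E′ .absent p q r s (x ∷ y ∷ z ∷ []) = nothing-P p q r s x y z

  -- The bound `y₀` is there for termination: the downward elbow lies in column `y₀` or later, and
  -- after a K-theoretic step `c` is a strictly larger bound of the same kind.
  undo : ∀ {y₀} → y₀ ≤ b → left (extend P a y₀) ≡ false →
    (∃[ P₀ ] P₀ ⟶ P × Before a (suc b) P₀) ⊎
    (∃[ P₀ ] ∃[ c ] (y₀ < c × c < b) × P₀ ⟶ P × Before a b P₀ × elbows P₀ a b ≡ just upward × left (extend P₀ a c) ≡ false)
  undo {y₀} y₀≤b h-y₀ with switch (h a) y₀≤b h-y₀ (proj₁ (proj₁ (upward-edges ab)))
  ... | j , y₀≤j , j<b , h-aj , h-asj
    with last-change (λ x → h x (suc j)) (λ x → h x (suc b)) a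
           (λ x x<a → RowAbove.stays x<a (s≤s (ℕ.<⇒≤ j<b)) b<n)
  -- No row above `a` has an elbow in column `b`, so the absence of pipes at the top boundary
  -- descends to the top edge of the upward elbow, a contradiction.
  ... | inj₂ rest = ¬both
    (ascend (λ x → v x b ≡ false) z≤n
      (λ x _ x<a → trans (sym (top-straight (row-empty x<a (rest x x<a) b j<b ℕ.≤-refl))))
      (top-first b))
    (proj₁ (proj₂ (upward-edges ab)))
  ... | inj₁ (i , i<a , h-isj , h-isb , rest) with switch (h i) (s≤s (ℕ.<⇒≤ j<b)) h-isj h-isb
  ... | c , j<c , c<sb , h-ic , h-isc = answer
    where
    open Found i<a j<c (ℕ.≤-pred c<sb) h-aj h-asj h-ic h-isc rest
    answer : _
    answer with c ℕ.≟ b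
    ... | yes c≡b = inj₁ (flip , undo-droop c≡b)
    ... | no  c≢b = inj₂ (flip , c , (ℕ.≤-<-trans y₀≤j j<c , c<b) , undo-Kdroop₁ c<b)
      where c<b = ℕ.≤∧≢⇒< (ℕ.≤-pred c<sb) c≢b

-- Induction over the cells in reading order

⟶-resp-≈ : (P P′ Q : BPD n) → P′ ≈ P → P ⟶ Q → P′ ⟶ Q
⟶-resp-≈ P P′ Q P′≈P (m , al , res , same) = m , allowed m al , res ,
  λ x y ¬in → subst (λ t → SameElbow t (tile Q x y)) (sym (P′≈P x y)) (same x y ¬in)
  where
  exactly : ∀ R es → ElbowsAreExactly P R es → ElbowsAreExactly P′ R es
  exactly _ _ f x y e in-R = subst (λ t → t ≡ elbow e ⇔ _) (sym (P′≈P x y)) (f x y e in-R)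
  allowed : ∀ m → Allowed m P → Allowed m P′
  allowed (droop R) (f , bl)  = exactly R (before (droop R)) f , trans (P′≈P _ _) bl
  allowed m@(Kdroop₁ R _ _ _) f = exactly R (before m) f
  allowed m@(Kdroop₂ R _ _ _) f = exactly R (before m) f

module Reach {n} (w : Permutation′ n) where

  -- Taken up to `≈` because once no upward elbow is left, `Φ w` is only known to have the same
  -- tiles as `P`. By `⟶-resp-≈` the first move can then start from `Φ w` itself.
  Reachable : BPD n → Set
  Reachable P = ∃[ Q ] Star _⟶_ (Φ w) Q × Q ≈ P

  reachable-step : ∀ P Q → P ⟶ Q → Reachable P → Reachable Q
  reachable-step P Q P⟶Q (P′ , steps , P′≈P) =
    Q , steps ◅◅ (⟶-resp-≈ P P′ Q P′≈P P⟶Q ◅ ε) , λ _ _ → refl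

  pipes-back : ∀ P Q → P ⟶ Q → Pipes w Q → Pipes w P
  pipes-back P Q (m , al , res) pipes i = trans (∂-invariant m P Q al res i) (pipes i)

  -- It covers the pipe dreams whose upward elbows all lie at `(a , b)` or later, so the induction
  -- runs backwards from `ReachableFrom n 0`, where there are none.
  ReachableFrom : ℕ → ℕ → Set
  ReachableFrom a b = ∀ P → Pipes w P → Before a b P → Reachable P

  -- The number `k` bounds the distance from `y₀` to `b`. Each K-theoretic step shortens it while
  -- keeping the upward elbow; a droop removes the elbow and hands over to `next`.
  move-upward : ∀ {a b} → a < n → b < n → ReachableFrom a (suc b) →
    ∀ k {y₀} → b ≤ y₀ + k → y₀ ≤ b →
    ∀ P → Pipes w P → Before a b P → elbows P a b ≡ just upward → left (extend P a y₀) ≡ false → Reachable P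
  move-upward {a} {b} a<n b<n next k {y₀} b≤ y₀≤b P pipes B ab h with Undo.undo P a<n b<n B ab y₀≤b h
  ... | inj₁ (P₀ , P₀⟶P , B₀) = reachable-step P₀ P P₀⟶P (next P₀ (pipes-back P₀ P P₀⟶P pipes) B₀)
  ... | inj₂ (P₀ , c , (y₀<c , c<b) , P₀⟶P , B₀ , ab₀ , h₀) with k
  ...   | zero  = ⊥-elim (ℕ.<⇒≱ (ℕ.<-trans y₀<c c<b) (subst (b ≤_) (ℕ.+-identityʳ y₀) b≤))
  ...   | suc k = reachable-step P₀ P P₀⟶P (move-upward a<n b<n next k
    (ℕ.≤-trans b≤ (subst (_≤ c + k) (sym (ℕ.+-suc y₀ k)) (ℕ.+-monoˡ-≤ k y₀<c))) (ℕ.<⇒≤ c<b)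
    P₀ (pipes-back P₀ P P₀⟶P pipes) B₀ ab₀ h₀)

  private
    up-to : ∀ {A : ℕ → Set} {m x} → x < m ⊎ x ≡ m → (x < m → A x) → A m → A x
    up-to (inj₁ x<m)  f a = f x<m
    up-to (inj₂ refl) f a = a

    upward? : ∀ e → Dec (e ≡ just upward)
    upward? nothing         = no λ ()
    upward? (just downward) = no λ ()
    upward? (just upward)   = yes refl

  reachable-cell : ∀ {a b} → a < n → b < n → ReachableFrom a (suc b) → ReachableFrom a b
  reachable-cell {a} {b} a<n b<n next P pipes B with upward? (elbows P a b)
  ... | yes ab = move-upward a<n b<n next b ℕ.≤-refl z≤n P pipes B ab (Edges.left-first P a)
  ... | no ¬ab = next P pipes record
    { rows-above = Before.rows-above B
    ; row-left   = λ y y<sb → up-to {λ y → elbows P a y ≢ just upward} (ℕ.m<1+n⇒m<n∨m≡n y<sb) (Before.row-left B y) ¬ab }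

  reachable : ∀ P → Pipes w P → Reachable P
  reachable P pipes = descend (λ a → ReachableFrom a 0) z≤n
    (λ a _ a<n next → descend (ReachableFrom a) z≤n (λ b _ b<n → reachable-cell a<n b<n)
      λ P pipes B → next P pipes record
        { rows-above = λ x y x<sa y<n → up-to {λ x → elbows P x y ≢ just upward} (ℕ.m<1+n⇒m<n∨m≡n x<sa)
            (λ x<a → Before.rows-above B x y x<a y<n) (Before.row-left B y y<n)
        ; row-left   = λ _ () })
    (λ P pipes B → Φ w , ε , NoUpward.rothe P (Before.rows-above B) w pipes)
    P pipes record { rows-above = λ _ _ () ; row-left = λ _ () }

proposition4p5 : (n : ℕ) (w : Permutation′ n) →
    ((P : BPD n) → P ∈ Pipes w → (m : Move n) → Allowed m P →
    (∃[ Q ] Result m P Q) × ((Q : BPD n) → Result m P Q → Q ∈ Pipes w)) ×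
    ((P : BPD n) → P ∈ Pipes w → ∃[ Q ] Star _⟶_ (Φ w) Q × Q ≈ P)
proposition4p5 n w =
  (λ P P∈Pipes m allowed → result-exists m P allowed ,
    λ Q result i → trans (sym (∂-invariant m P Q allowed result i)) (P∈Pipes i)) ,
  Reach.reachable w
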